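{- Let $A=[\mathbf{a}_1,\ldots,\mathbf{a}_n]\in\mathbb{Z}_{\ge0}^{d\times n}$ and $B=[\mathbf{b}_1,\ldots,\mathbf{b}_m]\in\mathbb{Z}_{\ge0}^{d\times m}$, with $\mathbf{a}_n=\mathbf{b}_m=\mathbf{0}_d$, be of harmony, and suppose that $\mathrm{in}_{<_A}(I_A)\subset K[x_1,\ldots,x_n]$ and $\mathrm{in}_{<_B}(I_B)\subset K[y_1,\ldots,y_m]$ are squarefree with respect to reverse lexicographic orders $<_A$, $<_B$ such that $x_i<_A x_j$ whenever $i\ne j$ and $a_{ki}\le a_{kj}$ for all $1\le k\le d$, $x_n$ is the smallest variable for $<_A$, and $y_m$ is the smallest variable for $<_B$. Let $\mathcal{P}\subset\mathbb{R}^d$ be the lattice polytope with $\mathcal{P}\cap\mathbb{Z}^d=\{\mathbf{a}_1,\ldots,\mathbf{a}_n\}$ and $\mathcal{Q}\subset\mathbb{R}^d$ the lattice polytope with $\mathcal{Q}\cap\mathbb{Z}^d=\{\mathbf{b}_1,\ldots,\mathbf{b}_m\}$. Suppose that every integer point of $\mathbb{Z}^{d+1}$ is an integer linear combination of the integer points of $\Gamma(\mathcal{P},\mathcal{Q})\times\{1\}$, every integer point of $\mathbb{Z}^{d+2}$ is an integer linear combination of the integer points of $\Omega(\mathcal{P},\mathcal{Q})\times\{1\}$, \[\Gamma(\mathcal{P},\mathcal{Q})\cap\mathbb{Z}^d=\{\mathbf{a}_1,\ldots,\mathbf{a}_{n-1},-\mathbf{b}_1,\ldots,-\mathbf{b}_{m-1},\mathbf{0}_d\},\]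 and \[\Omega(\mathcal{P},\mathcal{Q})\cap\mathbb{Z}^{d+1}=\left\{\begin{bmatrix}\mathbf{a}_1\\1\end{bmatrix},\ldots,\begin{bmatrix}\mathbf{a}_n\\1\end{bmatrix},\begin{bmatrix}-\mathbf{b}_1\\-1\end{bmatrix},\ldots,\begin{bmatrix}-\mathbf{b}_m\\-1\end{bmatrix},\mathbf{0}_{d+1}\right\}.\] Then $\delta(\Omega(\mathcal{P},\mathcal{Q}),\lambda)=(1+\lambda)\,\delta(\Gamma(\mathcal{P},\mathcal{Q}),\lambda)$. In particular $\mathrm{vol}(\Omega(\mathcal{P},\mathcal{Q}))=2\cdot\mathrm{vol}(\Gamma(\mathcal{P},\mathcal{Q}))$.
   Context: $K$ is a field. For an integer $d\times n$ matrix $A=[\mathbf{a}_1,\ldots,\mathbf{a}_n]$, the toric ideal $I_A$ is the kernel of $K[x_1,\ldots,x_n]\to K[t_1^{\pm1},\ldots,t_d^{\pm1},s]$, $x_j\mapsto\mathbf{t}^{\mathbf{a}_j}s$. The reverse lexicographic order induced by $x_n<\cdots<x_1$: $x^a<x^b$ iff $\sum a_i<\sum b_i$, or the degrees are equal and the rightmost nonzero entry of $b-a$ is negative. An initial ideal is squarefree if generated by squarefree monomials. For $\mathbf{c}\in\mathbb{Z}^d$, $\mathbf{c}^{(+)}$, $\mathbf{c}^{(-)}$ have entries $\max\{0,c_i\}$, $\max\{0,-c_i\}$. $A\in\mathbb{Z}_{\ge0}^{d\times n}$, $B\in\mathbb{Z}_{\ge0}^{d\times m}$, each having $\mathbf{0}_d$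 as a column, are of harmony if for every column $\mathbf{a}$ of $A$ and $\mathbf{b}$ of $B$, with $\mathbf{c}=\mathbf{a}-\mathbf{b}$, $\mathbf{c}^{(+)}$ is a column of $A$ and $\mathbf{c}^{(-)}$ a column of $B$. $\Gamma(\mathcal{P},\mathcal{Q})=\mathrm{conv}(\mathcal{P}\cup(-\mathcal{Q}))\subset\mathbb{R}^d$ and $\Omega(\mathcal{P},\mathcal{Q})=\mathrm{conv}((\mathcal{P}\times\{1\})\cup(-\mathcal{Q}\times\{ -1\}))\subset\mathbb{R}^{d+1}$. For a full-dimensional lattice polytope $\mathcal{R}\subset\mathbb{R}^N$, $\delta(\mathcal{R},\lambda)=(1-\lambda)^{N+1}[1+\sum_{n\ge1}|n\mathcal{R}\cap\mathbb{Z}^N|\lambda^n]$ and $\mathrm{vol}(\mathcal{R})=\delta(\mathcal{R},1)$ (normalized volume). -}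

module Defs where

open import Level using (Level; _⊔_) renaming (suc to lsuc; zero to lzero)
open import Data.Nat as ℕ using (ℕ; zero; suc; _∸_; _≤_; _<_)
open import Data.Nat.Combinatorics using (_C_)
open import Data.Integer as ℤ using (ℤ; +_)
open import Data.Rational as ℚ using (ℚ; 0ℚ; 1ℚ)
open import Data.Fin using (Fin)
open import Data.Vec as Vec using (Vec; []; _∷_; lookup; replicate; zipWith; _∷ʳ_; toList; init)
open import Data.Vec.Membership.Propositional renaming (_∈_ to _∈ᵥ_)
open import Data.Vec.Properties using (≡-dec)
open import Data.List as List using (List; []; _∷_; _++_; length; upTo)
open import Data.List.Relation.Unary.All using (All)
open import Data.List.Relation.Unary.Unique.Propositional using (Unique)
open import Data.List.Membership.Propositional using (_∈_)
open import Data.Product using (Σ; _×_; _,_)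
open import Data.Sum using (_⊎_)
open import Relation.Nullary using (¬_; yes; no)
open import Relation.Binary.PropositionalEquality using (_≡_)
open import Algebra.Bundles using (CommutativeRing)

record Field (c ℓ : Level) : Set (lsuc (c ⊔ ℓ)) where
  field
    commutativeRing : CommutativeRing c ℓ
  open CommutativeRing commutativeRing public
  field
    1≉0     : ¬ (1# ≈ 0#)
    inverse : ∀ x → ¬ (x ≈ 0#) → Σ Carrier (λ y → (x * y) ≈ 1#)

Mon : ℕ → Set
Mon n = Vec ℕ n

deg : ∀ {n} → Mon n → ℕ
deg = Vec.sum

Divides : ∀ {n} → Mon n → Mon n → Set
Divides v u = ∀ i → lookup v i ≤ lookup u i

Squarefree : ∀ {n} → Mon n → Set
Squarefree g = ∀ i → lookup g i ≤ 1

-- Reverse lexicographic order induced by a total order of the variables,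
-- given by an (injective) rank function: variable j is smaller than
-- variable k iff rank j < rank k.  RevLexLt rank u v  means  x^u < x^v:
-- deg u < deg v, or equal degrees and at the smallest variable x_k where
-- u and v differ (the "rightmost" one) the entry of v - u is negative.
RevLexLt : ∀ {n} → (Fin n → ℕ) → Mon n → Mon n → Set
RevLexLt {n} rank u v =
  deg u < deg v ⊎
  (deg u ≡ deg v × Σ (Fin n) (λ k → lookup v k < lookup u k ×
                                      (∀ j → rank j < rank k → lookup u j ≡ lookup v j)))

matVec : ∀ {d n} → Vec (Vec ℕ d) n → Vec ℕ n → Vec ℕ d
matVec {d} [] [] = replicate d 0
matVec (a ∷ as) (k ∷ ks) = zipWith ℕ._+_ (Vec.map (k ℕ.*_) a) (matVec as ks)

module Poly {c ℓ} (K : Field c ℓ) where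
  open Field K

  Pol : ℕ → Set c
  Pol n = List (Carrier × Mon n)

  coeff : ∀ {n} → Pol n → Mon n → Carrier
  coeff [] u = 0#
  coeff ((a , v) ∷ f) u with ≡-dec ℕ._≟_ v u
  ... | yes _ = a + coeff f u
  ... | no  _ = coeff f u

  -- coefficient of t^w s^e in the image of f under x_j ↦ t^{a_j} s
  imageCoeff : ∀ {d n} → Vec (Vec ℕ d) n → Pol n → Vec ℕ d → ℕ → Carrier
  imageCoeff A [] w e = 0#
  imageCoeff A ((a , v) ∷ f) w e with ≡-dec ℕ._≟_ (matVec A v) w | deg v ℕ.≟ e
  ... | yes _ | yes _ = a + imageCoeff A f w e
  ... | _     | _     = imageCoeff A f w e

  InToric : ∀ {d n} → Vec (Vec ℕ d) n → Pol n → Set ℓ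
  InToric A f = ∀ w e → imageCoeff A f w e ≈ 0#

  LeadMon : ∀ {n} → (Fin n → ℕ) → Pol n → Mon n → Set ℓ
  LeadMon rank f u = ¬ (coeff f u ≈ 0#) × (∀ v → RevLexLt rank u v → coeff f v ≈ 0#)

  InInitial : ∀ {d n} → Vec (Vec ℕ d) n → (Fin n → ℕ) → Mon n → Set (c ⊔ ℓ)
  InInitial A rank u =
    Σ (Pol _) (λ f → InToric A f × Σ (Mon _) (λ v → LeadMon rank f v × Divides v u))

  SquarefreeInitial : ∀ {d n} → Vec (Vec ℕ d) n → (Fin n → ℕ) → Set (lsuc lzero ⊔ c ⊔ ℓ)
  SquarefreeInitial {n = n} A rank =
    Σ (Mon n → Set) (λ G →
      (∀ g → G g → Squarefree g) ×
      (∀ u → InInitial A rank u → Σ (Mon n) (λ g → G g × Divides g u)) ×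
      (∀ u g → G g → Divides g u → InInitial A rank u))

Harmony : ∀ {d n m} → Vec (Vec ℕ d) n → Vec (Vec ℕ d) m → Set
Harmony {d} A B =
  replicate d 0 ∈ᵥ A × replicate d 0 ∈ᵥ B ×
  (∀ a b → a ∈ᵥ A → b ∈ᵥ B → zipWith _∸_ a b ∈ᵥ A × zipWith _∸_ b a ∈ᵥ B)

-- Lattice polytopes given as convex hulls of finite lists of integer points.

toℚ : ℤ → ℚ
toℚ z = z ℚ./ 1

qcomb : ∀ {N} → List ℚ → List (Vec ℤ N) → Vec ℚ N
qcomb {N} (l ∷ ls) (v ∷ vs) = zipWith ℚ._+_ (Vec.map (λ z → l ℚ.* toℚ z) v) (qcomb ls vs)
qcomb {N} _ _ = replicate N 0ℚ

-- the integer point z lies in k · conv(V)   (k ≥ 1 in uses)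
InDil : ∀ {N} → ℕ → List (Vec ℤ N) → Vec ℤ N → Set
InDil k V z =
  Σ (List ℚ) (λ ls → length ls ≡ length V × All (0ℚ ℚ.≤_) ls ×
                      List.foldr ℚ._+_ 0ℚ ls ≡ toℚ (+ k) ×
                      qcomb ls V ≡ Vec.map toℚ z)

zcomb : ∀ {N} → List (ℤ × Vec ℤ N) → Vec ℤ N
zcomb {N} [] = replicate N (+ 0)
zcomb ((c , p) ∷ cs) = zipWith ℤ._+_ (Vec.map (c ℤ.*_) p) (zcomb cs)

LatticeGen : ∀ {N} → List (Vec ℤ N) → Set
LatticeGen {N} V =
  ∀ (z : Vec ℤ (suc N)) → Σ (List (ℤ × Vec ℤ N)) (λ cs →
     All (λ cp → InDil 1 V (Data.Product.proj₂ cp)) cs ×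
     z ≡ zcomb (List.map (λ cp → Data.Product.proj₁ cp , (Data.Product.proj₂ cp ∷ʳ + 1)) cs))

IsCount : ∀ {N} → (Vec ℤ N → Set) → ℕ → Set
IsCount {N} S c =
  Σ (List (Vec ℤ N)) (λ xs → Unique xs × length xs ≡ c × (∀ z → (z ∈ xs → S z) × (S z → z ∈ xs)))

EhrhartSpec : ∀ {N} → List (Vec ℤ N) → (ℕ → ℕ) → Set
EhrhartSpec V L = L 0 ≡ 1 × (∀ k → IsCount (InDil (suc k) V) (L (suc k)))

-- coefficient of λ^k in (1-λ)^{N+1} Σ_n L n λ^n
δcoeff : ℕ → (ℕ → ℕ) → ℕ → ℤ
δcoeff N L k = List.foldr ℤ._+_ (+ 0)
  (List.map (λ j → sgn j ℤ.* (+ ((suc N C j) ℕ.* L (k ∸ j)))) (upTo (suc k)))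
  where
  sgn : ℕ → ℤ
  sgn zero = + 1
  sgn (suc j) = ℤ.- sgn j

-- value at λ = 1 of the power series with coefficients h, when it is a polynomial
IsValueAt1 : (ℕ → ℤ) → ℤ → Set
IsValueAt1 h v = Σ ℕ (λ D → (∀ k → D < k → h k ≡ + 0) ×
                            List.foldr ℤ._+_ (+ 0) (List.map h (upTo (suc D))) ≡ v)

-- Γ(P,Q) and Ω(P,Q) for P = conv(columns of A), Q = conv(columns of B).

negℤ : ∀ {d} → Vec ℕ d → Vec ℤ d
negℤ = Vec.map (λ x → ℤ.- (+ x))

posℤ : ∀ {d} → Vec ℕ d → Vec ℤ d
posℤ = Vec.map +_

ΓV : ∀ {d n m} → Vec (Vec ℕ d) n → Vec (Vec ℕ d) m → List (Vec ℤ d)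
ΓV A B = List.map posℤ (toList A) ++ List.map negℤ (toList B)

ΩV : ∀ {d n m} → Vec (Vec ℕ d) n → Vec (Vec ℕ d) m → List (Vec ℤ (suc d))
ΩV A B = List.map (λ a → posℤ a ∷ʳ + 1) (toList A) ++
         List.map (λ b → negℤ b ∷ʳ ℤ.- (+ 1)) (toList B)

ΓPointsHyp : ∀ {d n m} → Vec (Vec ℕ d) (suc n) → Vec (Vec ℕ d) (suc m) → Set
ΓPointsHyp {d} A B = ∀ z → (InDil 1 (ΓV A B) z → z ∈ listing) × (z ∈ listing → InDil 1 (ΓV A B) z)
  where
  listing = List.map posℤ (toList (init A)) ++ List.map negℤ (toList (init B)) ++ (replicate d (+ 0) ∷ [])

ΩPointsHyp : ∀ {d n m} → Vec (Vec ℕ d) n → Vec (Vec ℕ d) m → Set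
ΩPointsHyp {d} A B = ∀ z → (InDil 1 (ΩV A B) z → z ∈ listing) × (z ∈ listing → InDil 1 (ΩV A B) z)
  where
  listing = ΩV A B ++ (replicate (suc d) (+ 0) ∷ [])

{-# OPTIONS --safe #-}
-- Call a monomial standard if it does not involve the smallest variable and is revlex-minimal among the
-- monomials with the same image t^w s^e.  Squarefreeness of the initial ideal means that being standard depends
-- only on the support; since the column of the smallest variable is zero, every w in the image of A has exactly
-- one standard monomial u with A u = w, and it has least degree.  By harmony every A u − B v can be rewritten,
-- without raising degrees, so that A u and B v have disjoint supports, and the resulting pair of standard
-- monomials is unique.  Such a pair exists for every z ∈ ℤ^d: if u represents (N + 1) z and z = s − s′, the pairs
-- g₁, g₂ of M u + s′ and (M + D) u + s′ have equal supports for suitable M and D > deg g₁, and then uniqueness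
-- forces ((N + 1) D) γ = ((N + 1) D − 1) g₁ + g₂ for the pair γ of M u + s, so g₁ ≤ γ and γ − g₁ represents z.
--
-- With α, β the degrees of the pair of z, z ∈ kΓ iff α + β ≤ k, and (z , t) ∈ kΩ iff 2 α ≤ k + t and
-- 2 β ≤ k − t.  Counting gives L_Ω(k + 1) = L_Ω(k) + L_Γ(k + 1) + L_Γ(k), which is the identity of δ-series.
module Submission where

open import Defs
open import Algebra.Bundles using (AbelianGroup)
open import Data.Empty using (⊥; ⊥-elim)
open import Data.Fin as Fin using (Fin; zero; suc; fromℕ)
open import Data.Integer using (ℤ; +_; -[1+_])
import Data.Integer as ℤ
import Data.Integer.Properties as ℤ
import Data.Integer.Solver as ℤSolver
open import Data.List as List using (List; []; _∷_; length)
open import Data.List.Membership.Propositional using (_∈_)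
open import Data.List.Relation.Unary.All as All using (All; []; _∷_)
open import Data.List.Relation.Unary.AllPairs using ([]; _∷_)
open import Data.List.Relation.Unary.Any as Any using (here; there)
open import Data.List.Relation.Unary.Unique.Propositional using (Unique)
open import Data.Nat using (ℕ; zero; suc; _≤_; _<_; _∸_; z≤n; s≤s)
import Data.Nat as ℕ
import Data.Nat.Properties as ℕ
import Data.Nat.Solver as ℕSolver
open import Data.Nat.Induction using (<-wellFounded)
open import Data.Nat.ListAction using (sum)
open import Data.Product using (Σ; ∃; _×_; _,_; proj₁; proj₂)
open import Data.Sum as Sum using (_⊎_; inj₁; inj₂)
open import Data.Vec as Vec using (Vec; []; _∷_; lookup; last; replicate; zipWith; toList; init; _∷ʳ_)
open import Data.Vec.Properties hiding (sum-++)
open import Function using (_∘_; id)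
open import Function.Definitions using (Injective)
open import Induction.WellFounded using (Acc; acc)
open import Relation.Binary.Definitions using (tri<; tri≈; tri>)
open import Relation.Binary.PropositionalEquality
open import Relation.Nullary using (¬_; Dec; yes; no; ¬?; _×-dec_)

-- The obstacle is saturation. A lattice point of a dilate comes with rational weights, hence with a
-- pair for some multiple `(N + 1) z`, and lattice generation writes `z` only as a difference of two
-- images. Neither is a pair for `z` itself. What helps is that representatives behave linearly as
-- long as the support does not grow. Along the ray of the points `M u + s′` only finitely many
-- supports occur, so one of them recurs at `M` and `M + D`. The point `M u + s` exceeds the first
-- of these two by `z`, which is the fraction `1 / ((N + 1) D)` of the segment between them; this is
-- the origin of the coefficients. The same linearity shows that multiplication by `N + 1` commutes
-- with passing to standard pairs. The two degrees of the pair of `z` therefore bound the two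
-- weights of every rational representation separately. Γ sees only the sum of these weights while Ω
-- sees each of them, and this is why the same two numbers decide membership in the dilates of both.

-- Exponent vectors and their images under a nonnegative matrix.

module Monomials where
  open import Data.Nat using (_+_; _*_)
  open import Data.Nat.Properties
  open ℕSolver using (module +-*-Solver)

  infixl 6 _⊕_
  infixr 7 _⊛_

  _⊕_ : ∀ {n} → Mon n → Mon n → Mon n
  _⊕_ = zipWith _+_

  _⊛_ : ∀ {n} → ℕ → Mon n → Mon n
  k ⊛ u = Vec.map (k *_) u

  𝟘 : ∀ {n} → Mon n
  𝟘 = replicate _ 0

  unit : ∀ {n} → Fin n → Mon n
  unit zero    = 1 ∷ 𝟘
  unit (suc i) = 0 ∷ unit i

  lookup-ext : ∀ {a} {X : Set a} {n} {u v : Vec X n} → (∀ i → lookup u i ≡ lookup v i) → u ≡ v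
  lookup-ext {u = []}    {[]}    eq = refl
  lookup-ext {u = x ∷ u} {y ∷ v} eq = cong₂ _∷_ (eq zero) (lookup-ext (λ i → eq (suc i)))

  lookup-⊕ : ∀ {n} (u v : Mon n) i → lookup (u ⊕ v) i ≡ lookup u i + lookup v i
  lookup-⊕ u v i = lookup-zipWith _+_ i u v

  lookup-⊛ᵐ : ∀ {n} k (u : Mon n) i → lookup (k ⊛ u) i ≡ k * lookup u i
  lookup-⊛ᵐ k u i = lookup-map i (k *_) u

  ⊛-support : ∀ {n} k (u : Mon n) i → 0 < lookup (k ⊛ u) i → 0 < lookup u i
  ⊛-support k u i 0<ku with lookup u i in uᵢ
  ... | suc _ = s≤s z≤n
  ... | zero  = ⊥-elim (<-irrefl refl (subst (0 <_) (trans (lookup-⊛ᵐ k u i) (trans (cong (k *_) uᵢ) (*-zeroʳ k))) 0<ku))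

  lookup-𝟘 : ∀ {n} (i : Fin n) → lookup 𝟘 i ≡ 0
  lookup-𝟘 i = lookup-replicate i 0

  lookup-unit : ∀ {n} (i : Fin n) → lookup (unit i) i ≡ 1
  lookup-unit zero = refl
  lookup-unit (suc i) = lookup-unit i

  lookup-unit′ : ∀ {n} (i j : Fin n) → i ≢ j → lookup (unit i) j ≡ 0
  lookup-unit′ zero zero ne = ⊥-elim (ne refl)
  lookup-unit′ zero (suc j) ne = lookup-𝟘 j
  lookup-unit′ (suc i) zero ne = refl
  lookup-unit′ (suc i) (suc j) ne = lookup-unit′ i j (λ e → ne (cong suc e))

  lookup-fromℕ : ∀ {a} {X : Set a} n (xs : Vec X (suc n)) → lookup xs (fromℕ n) ≡ last xs
  lookup-fromℕ zero    (x ∷ [])     = refl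
  lookup-fromℕ (suc n) (x ∷ y ∷ xs) = lookup-fromℕ n (y ∷ xs)

  ⊕-identityˡ : ∀ {n} (u : Mon n) → 𝟘 ⊕ u ≡ u
  ⊕-identityˡ = zipWith-identityˡ +-identityˡ

  interchange : ∀ a b c d → (a + b) + (c + d) ≡ (a + c) + (b + d)
  interchange = solve 4 (λ a b c d → (a :+ b) :+ (c :+ d) := (a :+ c) :+ (b :+ d)) refl
    where open +-*-Solver

  deg-⊕ : ∀ {n} (u v : Mon n) → deg (u ⊕ v) ≡ deg u + deg v
  deg-⊕ []      []      = refl
  deg-⊕ (x ∷ u) (y ∷ v) = trans (cong (λ s → x + y + s) (deg-⊕ u v)) (interchange x y _ _)

  deg-⊛ : ∀ {n} k (u : Mon n) → deg (k ⊛ u) ≡ k * deg u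
  deg-⊛ k []      = sym (*-zeroʳ k)
  deg-⊛ k (x ∷ u) = trans (cong (λ s → k * x + s) (deg-⊛ k u)) (sym (*-distribˡ-+ k x (deg u)))

  deg-𝟘 : ∀ {n} → deg (𝟘 {n}) ≡ 0
  deg-𝟘 {zero}  = refl
  deg-𝟘 {suc n} = deg-𝟘 {n}

  deg-unit : ∀ {n} (i : Fin n) → deg (unit i) ≡ 1
  deg-unit {suc n} zero = cong suc (deg-𝟘 {n})
  deg-unit (suc i) = deg-unit i

  lookup≤deg : ∀ {n} (u : Mon n) i → lookup u i ≤ deg u
  lookup≤deg (x ∷ u) zero    = m≤m+n x _
  lookup≤deg (x ∷ u) (suc i) = ≤-trans (lookup≤deg u i) (m≤n+m _ x)

  divides⇒⊕ : ∀ {n} {g u : Mon n} → Divides g u → u ≡ g ⊕ zipWith _∸_ u g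
  divides⇒⊕ {g = g} {u} g∣u = lookup-ext λ i → sym (trans (lookup-⊕ g _ i)
    (trans (cong (lookup g i ℕ.+_) (lookup-zipWith _∸_ i u g)) (m+[n∸m]≡n (g∣u i))))

  positive⇒unit : ∀ {n} (u : Mon n) i → 0 < lookup u i → ∃ λ u′ → u ≡ unit i ⊕ u′
  positive⇒unit u i 0<uᵢ = _ , divides⇒⊕ unit∣u
    where
    unit∣u : Divides (unit i) u
    unit∣u j with i Fin.≟ j
    ... | yes refl = subst (_≤ lookup u i) (sym (lookup-unit i)) 0<uᵢ
    ... | no  i≢j  = subst (_≤ lookup u j) (sym (lookup-unit′ i j i≢j)) z≤n

  module _ {d : ℕ} where

    ⊛-𝟘 : (a : Mon d) → 0 ⊛ a ≡ 𝟘
    ⊛-𝟘 a = map-const a 0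

    ⊛-one : (a : Mon d) → 1 ⊛ a ≡ a
    ⊛-one a = trans (map-cong *-identityˡ a) (map-id a)

    ⊛-distribʳ-⊕ : (a : Mon d) (j k : ℕ) → (j + k) ⊛ a ≡ (j ⊛ a) ⊕ (k ⊛ a)
    ⊛-distribʳ-⊕ a j k = lookup-ext λ i → trans (lookup-⊛ᵐ (j + k) a i) (trans
      (*-distribʳ-+ (lookup a i) j k)
      (sym (trans (lookup-⊕ (j ⊛ a) (k ⊛ a) i) (cong₂ _+_ (lookup-⊛ᵐ j a i) (lookup-⊛ᵐ k a i)))))

    ⊕-interchange : (a b c e : Mon d) → (a ⊕ b) ⊕ (c ⊕ e) ≡ (a ⊕ c) ⊕ (b ⊕ e)
    ⊕-interchange a b c e = lookup-ext λ i → begin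
      lookup ((a ⊕ b) ⊕ (c ⊕ e)) i                          ≡⟨ four a b c e i ⟩
      (lookup a i + lookup b i) + (lookup c i + lookup e i) ≡⟨ interchange (lookup a i) _ _ _ ⟩
      (lookup a i + lookup c i) + (lookup b i + lookup e i) ≡⟨ sym (four a c b e i) ⟩
      lookup ((a ⊕ c) ⊕ (b ⊕ e)) i                          ∎
      where
      open ≡-Reasoning
      four : (a b c e : Mon d) → ∀ i → lookup ((a ⊕ b) ⊕ (c ⊕ e)) i ≡ (lookup a i + lookup b i) + (lookup c i + lookup e i)
      four a b c e i = trans (lookup-⊕ (a ⊕ b) (c ⊕ e) i) (cong₂ _+_ (lookup-⊕ a b i) (lookup-⊕ c e i))

    matVec-⊕ : ∀ {n} (A : Vec (Vec ℕ d) n) (u v : Mon n) → matVec A (u ⊕ v) ≡ matVec A u ⊕ matVec A v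
    matVec-⊕ []      []      []      = sym (⊕-identityˡ 𝟘)
    matVec-⊕ (a ∷ A) (j ∷ u) (k ∷ v) = trans
      (cong₂ _⊕_ (⊛-distribʳ-⊕ a j k) (matVec-⊕ A u v)) (⊕-interchange (j ⊛ a) (k ⊛ a) _ _)

    matVec-𝟘 : ∀ {n} (A : Vec (Vec ℕ d) n) → matVec A 𝟘 ≡ 𝟘
    matVec-𝟘 []      = refl
    matVec-𝟘 (a ∷ A) = trans (cong₂ _⊕_ (⊛-𝟘 a) (matVec-𝟘 A)) (⊕-identityˡ 𝟘)

    matVec-⊛ : ∀ {n} (A : Vec (Vec ℕ d) n) k (u : Mon n) → matVec A (k ⊛ u) ≡ k ⊛ matVec A u
    matVec-⊛ A zero    u = trans (cong (matVec A) (map-const u 0)) (trans (matVec-𝟘 A) (sym (⊛-𝟘 _)))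
    matVec-⊛ A (suc k) u = begin
      matVec A ((1 + k) ⊛ u)               ≡⟨ cong (matVec A) (suc-⊛ u) ⟩
      matVec A (u ⊕ (k ⊛ u))               ≡⟨ matVec-⊕ A u (k ⊛ u) ⟩
      matVec A u ⊕ matVec A (k ⊛ u)        ≡⟨ cong (matVec A u ⊕_) (matVec-⊛ A k u) ⟩
      matVec A u ⊕ (k ⊛ matVec A u)        ≡⟨ sym (suc-⊛ (matVec A u)) ⟩
      suc k ⊛ matVec A u                   ∎
      where
      open ≡-Reasoning
      suc-⊛ : ∀ {n} (w : Mon n) → suc k ⊛ w ≡ w ⊕ (k ⊛ w)
      suc-⊛ []      = refl
      suc-⊛ (x ∷ w) = cong (_ ∷_) (suc-⊛ w)

    matVec-unit : ∀ {n} (A : Vec (Vec ℕ d) n) j → matVec A (unit j) ≡ lookup A j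
    matVec-unit (a ∷ A) zero    = trans (cong₂ _⊕_ (⊛-one a) (matVec-𝟘 A)) (zipWith-identityʳ +-identityʳ a)
    matVec-unit (a ∷ A) (suc j) = trans (cong₂ _⊕_ (⊛-𝟘 a) (matVec-unit A j)) (⊕-identityˡ _)

    -- All entries are nonnegative, so nothing cancels and the support of `A u` depends only on the
    -- supports of `u` and of the columns. This finds overlapping columns, and together with its
    -- converse it carries disjointness over to smaller supports.
    matVec-positive⁻ : ∀ {n} (A : Vec (Vec ℕ d) n) u i → 0 < lookup (matVec A u) i →
                       ∃ λ j → 0 < lookup u j × 0 < lookup (lookup A j) i
    matVec-positive⁻ [] [] i 0<0 = ⊥-elim (<-irrefl refl (subst (0 <_) (lookup-𝟘 i) 0<0))
    matVec-positive⁻ (a ∷ A) (zero ∷ u) i pos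
      with j , p , q ← matVec-positive⁻ A u i
             (subst (λ w → 0 < lookup w i) (trans (cong (_⊕ _) (⊛-𝟘 a)) (⊕-identityˡ _)) pos) = suc j , p , q
    matVec-positive⁻ (a ∷ A) (suc k ∷ u) i pos with lookup a i in aᵢ
    ... | suc _ = zero , s≤s z≤n , subst (0 <_) (sym aᵢ) (s≤s z≤n)
    ... | zero = let j , p , q = matVec-positive⁻ A u i (subst (0 <_) tail-only pos) in suc j , p , q
      where
      open ≡-Reasoning
      tail-only : lookup ((suc k ⊛ a) ⊕ matVec A u) i ≡ lookup (matVec A u) i
      tail-only = begin
        lookup ((suc k ⊛ a) ⊕ matVec A u) i          ≡⟨ lookup-⊕ (suc k ⊛ a) (matVec A u) i ⟩
        lookup (suc k ⊛ a) i + lookup (matVec A u) i ≡⟨ cong (_+ _) (lookup-⊛ᵐ (suc k) a i) ⟩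
        suc k * lookup a i + lookup (matVec A u) i   ≡⟨ cong (λ x → suc k * x + _) aᵢ ⟩
        suc k * 0 + lookup (matVec A u) i            ≡⟨ cong (_+ lookup (matVec A u) i) (*-zeroʳ (suc k)) ⟩
        lookup (matVec A u) i                        ∎

    matVec-positive⁺ : ∀ {n} (A : Vec (Vec ℕ d) n) u i j → 0 < lookup u j → 0 < lookup (lookup A j) i →
                       0 < lookup (matVec A u) i
    matVec-positive⁺ A u i j 0<uⱼ 0<aᵢ with u′ , refl ← positive⇒unit u j 0<uⱼ = begin-strict
      0                                                       <⟨ 0<aᵢ ⟩
      lookup (lookup A j) i                                   ≡⟨ cong (λ w → lookup w i) (sym (matVec-unit A j)) ⟩
      lookup (matVec A (unit j)) i                            ≤⟨ m≤m+n _ _ ⟩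
      lookup (matVec A (unit j)) i + lookup (matVec A u′) i   ≡⟨ sym (lookup-⊕ (matVec A (unit j)) (matVec A u′) i) ⟩
      lookup (matVec A (unit j) ⊕ matVec A u′) i              ≡⟨ cong (λ w → lookup w i) (sym (matVec-⊕ A (unit j) u′)) ⟩
      lookup (matVec A (unit j ⊕ u′)) i                       ∎
      where open ≤-Reasoning

open Monomials

-- Toric fibres, squarefree initial ideals and standard monomials.

module Toric where
  open import Data.Nat using (_+_; _*_)
  open import Data.Nat.Properties
  open import Data.Fin.Properties using (any?; all?; ¬∀⟶∃¬)
  open import Data.List using (upTo; cartesianProductWith; filter)
  open import Data.List.Properties using (length-filter)
  open import Data.List.Membership.Propositional.Properties using (∈-cartesianProductWith⁺; ∈-upTo⁺)

  -- A box is enough: all that is needed is a finite list that contains the fibre of a monomial of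
  -- degree `e`.
  enumerate : ∀ n → ℕ → List (Mon n)
  enumerate zero    e = [] ∷ []
  enumerate (suc n) e = cartesianProductWith _∷_ (upTo (suc e)) (enumerate n e)

  ∈-enumerate : ∀ {n} e (u : Mon n) → (∀ i → lookup u i ≤ e) → u ∈ enumerate n e
  ∈-enumerate e []      bnd = here refl
  ∈-enumerate e (x ∷ u) bnd = ∈-cartesianProductWith⁺ _∷_
    (∈-upTo⁺ (s≤s (bnd zero))) (∈-enumerate e u (λ i → bnd (suc i)))

  module Fibre {d n} (A : Vec (Vec ℕ d) n) (rank : Fin n → ℕ) (rank-injective : Injective _≡_ _≡_ rank) where

    -- The equal-degree clause of `RevLexLt`, oriented so that `v` is the smaller monomial: it has
    -- more of the smallest variable in which the two differ. The equality of degrees is carried by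
    -- `SameFibre`.
    record Below (v u : Mon n) : Set where
      constructor below
      field
        pivot  : Fin n
        larger : lookup u pivot < lookup v pivot
        agree  : ∀ j → rank j < rank pivot → lookup v j ≡ lookup u j

    Below-irrefl : ∀ {u} → ¬ Below u u
    Below-irrefl (below k u<u _) = <-irrefl refl u<u

    Below-trans : ∀ {u v w} → Below u v → Below v w → Below u w
    Below-trans {u} {v} {w} (below j v<u agⱼ) (below k w<v agₖ) with <-cmp (rank j) (rank k)
    ... | tri< j<k _ _ = below j (subst (_< lookup u j) (agₖ j j<k) v<u)
                           λ i i<j → trans (agⱼ i i<j) (agₖ i (<-trans i<j j<k))
    ... | tri> _ _ k<j = below k (subst (lookup w k <_) (sym (agⱼ k k<j)) w<v)
                           λ i i<k → trans (agⱼ i (<-trans i<k k<j)) (agₖ i i<k)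
    ... | tri≈ _ j≈k _ with refl ← rank-injective j≈k =
      below k (<-trans w<v v<u) λ i i<k → trans (agⱼ i i<k) (agₖ i i<k)

    -- The ranks are unrelated to the order of `Fin n`, so the search descends along ranks, which
    -- are natural numbers, instead of scanning positions.
    lowest-difference : ∀ u v k → Acc _<_ (rank k) → lookup u k ≢ lookup v k →
      ∃ λ j → lookup u j ≢ lookup v j × (∀ i → rank i < rank j → lookup u i ≡ lookup v i)
    lowest-difference u v k (acc rec) u≢v
      with any? (λ j → (rank j ℕ.<? rank k) ×-dec ¬? (lookup u j ℕ.≟ lookup v j))
    ... | yes (j , j<k , ne) = lowest-difference u v j (rec j<k) ne
    ... | no  none = k , u≢v , agree
      where
      agree : ∀ i → rank i < rank k → lookup u i ≡ lookup v i
      agree i i<k with lookup u i ℕ.≟ lookup v i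
      ... | yes eq = eq
      ... | no  ne = ⊥-elim (none (i , i<k , ne))

    compare : ∀ u v → Below u v ⊎ u ≡ v ⊎ Below v u
    compare u v with all? (λ i → lookup u i ℕ.≟ lookup v i)
    ... | yes eq = inj₂ (inj₁ (lookup-ext eq))
    ... | no ¬eq with i , ne ← ¬∀⟶∃¬ n _ (λ i → lookup u i ℕ.≟ lookup v i) ¬eq
      with j , u≢v , agree ← lowest-difference u v i (<-wellFounded _) ne
      with <-cmp (lookup u j) (lookup v j)
    ... | tri< u<v _ _ = inj₂ (inj₂ (below j u<v λ i i<j → sym (agree i i<j)))
    ... | tri≈ _ u≡v _ = ⊥-elim (u≢v u≡v)
    ... | tri> _ _ v<u = inj₁ (below j v<u agree)

    below? : ∀ u v → Dec (Below u v)
    below? u v with compare u v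
    ... | inj₁ u<v         = yes u<v
    ... | inj₂ (inj₁ refl) = no Below-irrefl
    ... | inj₂ (inj₂ v<u)  = no λ u<v → Below-irrefl (Below-trans u<v v<u)

    SameFibre : Mon n → Mon n → Set
    SameFibre u v = matVec A u ≡ matVec A v × deg u ≡ deg v

    sameFibre? : ∀ u v → Dec (SameFibre u v)
    sameFibre? u v = ≡-dec ℕ._≟_ (matVec A u) (matVec A v) ×-dec (deg u ℕ.≟ deg v)

    SameFibre-trans : ∀ {u v w} → SameFibre u v → SameFibre v w → SameFibre u w
    SameFibre-trans (p , q) (r , s) = trans p r , trans q s

    SameFibre-sym : ∀ {u v} → SameFibre u v → SameFibre v u
    SameFibre-sym (p , q) = sym p , sym q

    -- The combinatorial form of membership in the initial ideal. It mentions neither coefficients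
    -- nor polynomials; the equivalence is `initial⇒reducible` and `reducible⇒initial`.
    Reducible : Mon n → Set
    Reducible u = ∃ λ v → SameFibre v u × Below v u

    -- Multiplying both monomials by the cofactor `r` adds the same vector to both images and the
    -- same number at every variable, so fibre, pivot and agreement below the pivot all persist.
    Reducible-divides : ∀ {g u} → Divides g u → Reducible g → Reducible u
    Reducible-divides {g} {u} g∣u (v , (same , eq) , below k g<v agree) =
      v ⊕ r , subst (SameFibre (v ⊕ r)) (sym u≡) sameᵣ , subst (Below (v ⊕ r)) (sym u≡) belowᵣ
      where
      r = zipWith _∸_ u g
      u≡ : u ≡ g ⊕ r
      u≡ = divides⇒⊕ g∣u
      sameᵣ : SameFibre (v ⊕ r) (g ⊕ r)
      sameᵣ = trans (matVec-⊕ A v r) (trans (cong (_⊕ matVec A r) same) (sym (matVec-⊕ A g r))) ,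
              trans (deg-⊕ v r) (trans (cong (_+ deg r) eq) (sym (deg-⊕ g r)))
      belowᵣ : Below (v ⊕ r) (g ⊕ r)
      belowᵣ = below k (subst₂ _<_ (sym (lookup-⊕ g r k)) (sym (lookup-⊕ v r k)) (+-monoˡ-< _ g<v))
        λ j j<k → trans (lookup-⊕ v r j) (trans (cong (_+ lookup r j) (agree j j<k)) (sym (lookup-⊕ g r j)))

    least : ∀ (l : List (Mon n)) u → ∃ λ w → SameFibre w u × (∀ v → v ∈ l → SameFibre v u → ¬ Below v w)
    least []      u = u , (refl , refl) , λ _ ()
    least (x ∷ l) u with w , same , min ← least l u | sameFibre? x u
    ... | no ¬x = w , same , λ { v (here refl) v~ _ → ¬x v~ ; v (there v∈l) v~ → min v v∈l v~ }
    ... | yes x~u with below? x w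
    ...   | yes x<w = x , x~u , λ { v (here refl) _ → Below-irrefl
                                  ; v (there v∈l) v~ v<x → min v v∈l v~ (Below-trans v<x x<w) }
    ...   | no ¬x<w = w , same , λ { v (here refl) _ → ¬x<w ; v (there v∈l) v~ → min v v∈l v~ }

    -- Within a fibre the degree is constant and bounds every exponent. The fibre is thus finite and
    -- has a least element.
    irreducible-representative : ∀ u → ∃ λ w → SameFibre w u × ¬ Reducible w
    irreducible-representative u with w , same , min ← least (enumerate n (deg u)) u =
      w , same , λ { (v , v~w , v<w) → let v~u = SameFibre-trans v~w same in
        min v (∈-enumerate (deg u) v (λ i → ≤-trans (lookup≤deg v i) (≤-reflexive (proj₂ v~u)))) v~u v<w }

    irreducible-unique : ∀ {u v} → ¬ Reducible u → ¬ Reducible v → SameFibre u v → u ≡ v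
    irreducible-unique {u} {v} mu mv u~v with compare u v
    ... | inj₁ u<v        = ⊥-elim (mv (u , u~v , u<v))
    ... | inj₂ (inj₁ u≡v) = u≡v
    ... | inj₂ (inj₂ v<u) = ⊥-elim (mu (v , SameFibre-sym u~v , v<u))

    -- The initial ideal consists of the reducible monomials.

    module _ {c ℓ} (K : Field c ℓ) where
      open Field K using (Carrier; _≈_; 0#; 1#; 1≉0; -_)
      open Poly K
      private module R = Field K
      open import Relation.Binary.Reasoning.Setoid R.setoid

      module _ {p} {P : Mon n → Set p} (P? : ∀ v → Dec (P v)) where

        sumOver : Pol n → Carrier
        sumOver []            = 0#
        sumOver ((a , v) ∷ f) with P? v
        ... | yes _ = a R.+ sumOver f
        ... | no  _ = sumOver f

      _without_ : Pol n → Mon n → Pol n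
      f without v = filter (λ aw → ¬? (≡-dec ℕ._≟_ (proj₂ aw) v)) f

      coeff-without : ∀ f v w → w ≢ v → coeff (f without v) w ≈ coeff f w
      coeff-without [] v w w≢v = R.refl
      coeff-without ((a , x) ∷ f) v w w≢v with ≡-dec ℕ._≟_ x v
      coeff-without ((a , x) ∷ f) v w w≢v | yes refl with ≡-dec ℕ._≟_ x w
      ... | yes refl = ⊥-elim (w≢v refl)
      ... | no _     = coeff-without f x w w≢v
      coeff-without ((a , x) ∷ f) v w w≢v | no _ with ≡-dec ℕ._≟_ x w
      ... | yes _ = R.+-congˡ (coeff-without f v w w≢v)
      ... | no _  = coeff-without f v w w≢v

      coeff-without-self : ∀ f v → coeff (f without v) v ≈ 0#
      coeff-without-self [] v = R.refl
      coeff-without-self ((a , x) ∷ f) v with ≡-dec ℕ._≟_ x v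
      ... | yes _ = coeff-without-self f v
      ... | no x≢v with ≡-dec ℕ._≟_ x v
      ...   | yes x≡v = ⊥-elim (x≢v x≡v)
      ...   | no  _   = coeff-without-self f v

      module _ {p} {P : Mon n → Set p} (P? : ∀ v → Dec (P v)) where

        sumOver-split : ∀ f v → P v → sumOver P? f ≈ coeff f v R.+ sumOver P? (f without v)
        sumOver-split [] v pv = R.sym (R.+-identityˡ 0#)
        sumOver-split ((a , x) ∷ f) v pv with ≡-dec ℕ._≟_ x v
        sumOver-split ((a , x) ∷ f) v pv | yes refl with P? x
        ... | yes _  = R.trans (R.+-congˡ (sumOver-split f x pv)) (R.sym (R.+-assoc _ _ _))
        ... | no ¬px = ⊥-elim (¬px pv)
        sumOver-split ((a , x) ∷ f) v pv | no _ with P? x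
        ... | no  _ = sumOver-split f v pv
        ... | yes _ = begin
          a R.+ sumOver P? f                     ≈⟨ R.+-congˡ (sumOver-split f v pv) ⟩
          a R.+ (coeff f v R.+ s)                ≈⟨ R.sym (R.+-assoc _ _ _) ⟩
          (a R.+ coeff f v) R.+ s                ≈⟨ R.+-congʳ (R.+-comm _ _) ⟩
          (coeff f v R.+ a) R.+ s                ≈⟨ R.+-assoc _ _ _ ⟩
          coeff f v R.+ (a R.+ s)                ∎
          where s = sumOver P? (f without v)

        -- A monomial may occur in several terms, and only their total is known to vanish. The
        -- induction therefore removes all terms of the first monomial together; what remains is
        -- shorter but not a tail of the list, hence the accessibility argument.
        sumOver-vanishes : ∀ f → Acc _<_ (length f) → (∀ v → P v → coeff f v ≈ 0#) → sumOver P? f ≈ 0#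
        sumOver-vanishes [] _ zeros = R.refl
        sumOver-vanishes ((a , x) ∷ f) (acc rec) zeros with P? x | sumOver-split ((a , x) ∷ f) x
        ... | no ¬px | _ = sumOver-vanishes f (rec (n<1+n _)) zeros′
          where
          zeros′ : ∀ v → P v → coeff f v ≈ 0#
          zeros′ v pv with ≡-dec ℕ._≟_ x v | zeros v pv
          ... | yes refl | _ = ⊥-elim (¬px pv)
          ... | no  _    | z = z
        ... | yes px | split with P? x
        ...   | no ¬px = ⊥-elim (¬px px)
        ...   | yes _  = begin
          a R.+ sumOver P? f                                             ≈⟨ split px ⟩
          coeff ((a , x) ∷ f) x R.+ sumOver P? (((a , x) ∷ f) without x) ≈⟨ R.+-cong (zeros x px) rest ⟩
          0# R.+ 0#                                                      ≈⟨ R.+-identityˡ 0# ⟩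
          0#                                                             ∎
          where
          shorter : length (((a , x) ∷ f) without x) < suc (length f)
          shorter with ≡-dec ℕ._≟_ x x
          ... | yes _   = s≤s (length-filter _ f)
          ... | no  x≢x = ⊥-elim (x≢x refl)
          zeros′ : ∀ v → P v → coeff (((a , x) ∷ f) without x) v ≈ 0#
          zeros′ v pv with ≡-dec ℕ._≟_ v x
          ... | yes refl = coeff-without-self ((a , x) ∷ f) x
          ... | no  v≢x  = R.trans (coeff-without ((a , x) ∷ f) x v v≢x) (zeros v pv)
          rest = sumOver-vanishes (((a , x) ∷ f) without x) (rec shorter) zeros′

      imageCoeff-sumOver : ∀ f u → imageCoeff A f (matVec A u) (deg u) ≈ sumOver (λ v → sameFibre? v u) f
      imageCoeff-sumOver [] u = R.refl
      imageCoeff-sumOver ((a , v) ∷ f) u with ≡-dec ℕ._≟_ (matVec A v) (matVec A u) | deg v ℕ.≟ deg u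
      ... | yes _ | yes _ = R.+-congˡ (imageCoeff-sumOver f u)
      ... | yes _ | no  _ = imageCoeff-sumOver f u
      ... | no  _ | yes _ = imageCoeff-sumOver f u
      ... | no  _ | no  _ = imageCoeff-sumOver f u

      coeff-absent : ∀ (f : Pol n) v → ¬ Any.Any (λ aw → proj₂ aw ≡ v) f → coeff f v ≈ 0#
      coeff-absent [] v absent = R.refl
      coeff-absent ((a , x) ∷ f) v absent with ≡-dec ℕ._≟_ x v
      ... | yes x≡v = ⊥-elim (absent (here x≡v))
      ... | no  _   = coeff-absent f v (absent ∘ there)

      -- A coefficient of the image of `f` is the sum of the coefficients of `f` over one fibre. In
      -- the fibre of the leading monomial `v` everything larger has coefficient zero. If nothing
      -- smaller occurred either, the sum would be the leading coefficient, although it is zero.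
      initial⇒reducible : ∀ {u} → InInitial A rank u → Reducible u
      initial⇒reducible {u} (f , toric , v , (lead , above) , v∣u) = Reducible-divides v∣u reducible
        where
        -- The search runs over the listed terms because equality in `K` need not be decidable. A
        -- listed term may have total coefficient zero and still shows that `v` is reducible; a
        -- monomial that is not listed certainly has coefficient zero.
        witness? : ∀ aw → Dec (SameFibre (proj₂ aw) v × Below (proj₂ aw) v)
        witness? (_ , w) = sameFibre? w v ×-dec below? w v

        reducible : Reducible v
        reducible with Any.any? witness? f
        ... | yes any with (_ , w) , ok ← Any.satisfied any = w , ok
        ... | no none = ⊥-elim (lead (begin
          coeff f v                                            ≈⟨ R.sym (R.+-identityʳ _) ⟩
          coeff f v R.+ 0#                                     ≈⟨ R.+-congˡ (R.sym rest) ⟩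
          coeff f v R.+ sumOver fibre? (f without v)           ≈⟨ R.sym (sumOver-split fibre? f v (refl , refl)) ⟩
          sumOver fibre? f                                     ≈⟨ R.sym (imageCoeff-sumOver f v) ⟩
          imageCoeff A f (matVec A v) (deg v)                  ≈⟨ toric _ _ ⟩
          0#                                                   ∎))
          where
          fibre? = λ w → sameFibre? w v
          zeros : ∀ w → SameFibre w v → coeff (f without v) w ≈ 0#
          zeros w w~v with compare w v
          ... | inj₂ (inj₁ refl) = coeff-without-self f v
          ... | inj₁ w<v = R.trans (coeff-without f v w λ { refl → Below-irrefl w<v })
            (coeff-absent f w λ any → none (Any.map (λ { refl → w~v , w<v }) any))
          ... | inj₂ (inj₂ v<w@(below k lt agree)) = R.trans (coeff-without f v w λ { refl → Below-irrefl v<w })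
            (above w (inj₂ (sym (proj₂ w~v) , k , lt , agree)))
          rest = sumOver-vanishes fibre? (f without v) (<-wellFounded _) zeros

      -- The binomial with terms `u` and minus `v` lies in the toric ideal, and `u` is its leading
      -- monomial.
      reducible⇒initial : ∀ {u} → Reducible u → InInitial A rank u
      reducible⇒initial {u} (v , (same , eq) , v<u@(below k lt agree)) =
        f , toric , u , (lead , above) , λ _ → ≤-refl
        where
        f : Pol n
        f = (1# , u) ∷ (- 1# , v) ∷ []
        u≢v : u ≢ v
        u≢v refl = Below-irrefl v<u
        toric : InToric A f
        toric w e with ≡-dec ℕ._≟_ (matVec A u) w | deg u ℕ.≟ e
        ... | yes Au≡w | yes du≡e = R.trans (R.+-congˡ second) (R.-‿inverseʳ 1#)
          where
          second : imageCoeff A ((- 1# , v) ∷ []) w e ≈ - 1#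
          second with ≡-dec ℕ._≟_ (matVec A v) w | deg v ℕ.≟ e
          ... | yes _    | yes _    = R.+-identityʳ _
          ... | no  Av≢w | _        = ⊥-elim (Av≢w (trans same Au≡w))
          ... | yes _    | no  dv≢e = ⊥-elim (dv≢e (trans eq du≡e))
        ... | no Au≢w | _ with ≡-dec ℕ._≟_ (matVec A v) w | deg v ℕ.≟ e
        ...   | yes Av≡w | _     = ⊥-elim (Au≢w (trans (sym same) Av≡w))
        ...   | no  _    | yes _ = R.refl
        ...   | no  _    | no  _ = R.refl
        toric w e | yes _ | no du≢e with ≡-dec ℕ._≟_ (matVec A v) w | deg v ℕ.≟ e
        ...   | _     | yes dv≡e = ⊥-elim (du≢e (trans (sym eq) dv≡e))
        ...   | yes _ | no  _    = R.refl
        ...   | no  _ | no  _    = R.refl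
        lead : ¬ (coeff f u ≈ 0#)
        lead with ≡-dec ℕ._≟_ u u
        ... | no u≢u = ⊥-elim (u≢u refl)
        ... | yes _  = λ z → 1≉0 (R.trans (R.sym (R.+-identityʳ 1#)) (R.trans (R.+-congˡ (R.sym tail)) z))
          where
          tail = coeff-absent ((- 1# , v) ∷ []) u λ { (here v≡u) → u≢v (sym v≡u) }
        ¬above : ∀ w → (RevLexLt rank u w) → (w ≡ u ⊎ w ≡ v) → ⊥
        ¬above w (inj₁ du<du) (inj₁ refl) = <-irrefl refl du<du
        ¬above w (inj₁ du<dv) (inj₂ refl) = <-irrefl (sym eq) du<dv
        ¬above w (inj₂ (_ , k , lt , ag)) (inj₁ refl) = <-irrefl refl lt
        ¬above w (inj₂ (_ , k , lt , ag)) (inj₂ refl) = Below-irrefl (Below-trans v<u (below k lt ag))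
        above : ∀ w → RevLexLt rank u w → coeff f w ≈ 0#
        above w u<w = coeff-absent f w λ
          { (here u≡w)         → ¬above w u<w (inj₁ (sym u≡w))
          ; (there (here v≡w)) → ¬above w u<w (inj₂ (sym v≡w)) }

      -- This is where squarefreeness enters. A generator dividing `v` has exponents at most one and
      -- uses only variables of `v`, hence only variables of `u`, so it divides `u` as well.
      irreducible-support : SquarefreeInitial A rank →
        ∀ {u v} → (∀ i → 0 < lookup v i → 0 < lookup u i) → ¬ Reducible u → ¬ Reducible v
      irreducible-support (G , sqfree , hit , ideal) {u} {v} supp ¬red red
        with g , g∈G , g∣v ← hit v (reducible⇒initial red) =
        ¬red (Reducible-divides {g} g∣u (initial⇒reducible (ideal g g g∈G λ _ → ≤-refl)))
        where
        g∣u : Divides g u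
        g∣u i with lookup v i in vᵢ
        ... | zero  = ≤-trans (subst (lookup g i ≤_) vᵢ (g∣v i)) z≤n
        ... | suc _ = ≤-trans (sqfree g g∈G i) (supp i (subst (0 <_) (sym vᵢ) (s≤s z≤n)))

  -- All that the later parts see of the field, the ideal and the variable order. Disjointness of
  -- supports and lattice generation are the only further input to the existence of pairs.
  record StandardMonomials {d n} (A : Vec (Vec ℕ d) n) : Set₁ where
    field
      Standard       : Mon n → Set
      support        : ∀ {u v} → (∀ i → 0 < lookup v i → 0 < lookup u i) → Standard u → Standard v
      unique         : ∀ {u v} → Standard u → Standard v → matVec A u ≡ matVec A v → u ≡ v
      representative : ∀ u → ∃ λ v → Standard v × matVec A v ≡ matVec A u × deg v ≤ deg u

  module ZeroLast {d n} (A : Vec (Vec ℕ d) (suc n)) (last≡𝟘 : last A ≡ 𝟘) where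

    matVec-last : ∀ k → matVec A (k ⊛ unit (fromℕ n)) ≡ 𝟘
    matVec-last k = trans (matVec-⊛ A k (unit (fromℕ n))) (trans (cong (k ⊛_)
      (trans (matVec-unit A (fromℕ n)) (trans (lookup-fromℕ n A) last≡𝟘)))
      (lookup-ext λ i → trans (lookup-⊛ᵐ k 𝟘 i) (trans (cong (k *_) (lookup-𝟘 i)) (trans (*-zeroʳ k) (sym (lookup-𝟘 i))))))

    matVec-⊕-last : ∀ u k → matVec A (u ⊕ (k ⊛ unit (fromℕ n))) ≡ matVec A u
    matVec-⊕-last u k = trans (matVec-⊕ A u _) (trans (cong (matVec A u ⊕_) (matVec-last k))
      (zipWith-identityʳ +-identityʳ (matVec A u)))

    deg-⊕-last : ∀ u k → deg (u ⊕ (k ⊛ unit (fromℕ n))) ≡ deg u + k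
    deg-⊕-last u k = trans (deg-⊕ u _) (cong (deg u ℕ.+_)
      (trans (deg-⊛ k (unit (fromℕ n))) (trans (cong (k *_) (deg-unit (fromℕ n))) (*-identityʳ k))))

  module Standard {d n} (A : Vec (Vec ℕ d) (suc n)) (last≡𝟘 : last A ≡ 𝟘)
    (rank : Fin (suc n) → ℕ) (rank-injective : Injective _≡_ _≡_ rank)
    (last-smallest : ∀ i → i ≢ fromℕ n → rank (fromℕ n) < rank i)
    {c ℓ} (K : Field c ℓ) (squarefree : Poly.SquarefreeInitial K A rank) where

    open ZeroLast A last≡𝟘
    open Fibre A rank rank-injective

    Standard : Mon (suc n) → Set
    Standard u = lookup u (fromℕ n) ≡ 0 × ¬ Reducible u

    standard-support : ∀ {u v} → (∀ i → 0 < lookup v i → 0 < lookup u i) → Standard u → Standard v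
    standard-support {u} {v} supp (uₙ≡0 , irr) =
      n≮0⇒n≡0 (λ 0<vₙ → <-irrefl refl (subst (0 <_) uₙ≡0 (supp _ 0<vₙ))) ,
      irreducible-support K squarefree supp irr
      where
      n≮0⇒n≡0 : ∀ {x} → ¬ (0 < x) → x ≡ 0
      n≮0⇒n≡0 {zero}  _ = refl
      n≮0⇒n≡0 {suc x} h = ⊥-elim (h (s≤s z≤n))

    -- Powers of the last variable make up the difference of degrees without moving the image. The
    -- padded `u` then lies below `v`: the last variable is the smallest, it is absent from `v`, and
    -- no variable precedes it, so the agreement condition is vacuous.
    standard-deg≮ : ∀ {u v} → Standard u → Standard v → matVec A u ≡ matVec A v → ¬ (deg u < deg v)
    standard-deg≮ {u} {v} _ (vₙ≡0 , irr) eq du<dv = irr (u′ , same , below (fromℕ n) larger agree)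
      where
      k = deg v ∸ deg u
      u′ = u ⊕ (k ⊛ unit (fromℕ n))
      same : SameFibre u′ v
      same = trans (matVec-⊕-last u k) eq , trans (deg-⊕-last u k) (m+[n∸m]≡n (<⇒≤ du<dv))
      larger : lookup v (fromℕ n) < lookup u′ (fromℕ n)
      larger = begin-strict
        lookup v (fromℕ n)                                         ≡⟨ vₙ≡0 ⟩
        0                                                          <⟨ m<n⇒0<n∸m du<dv ⟩
        k                                                          ≡⟨ sym (*-identityʳ k) ⟩
        k * 1                                                      ≡⟨ cong (k *_) (sym (lookup-unit (fromℕ n))) ⟩
        k * lookup (unit (fromℕ n)) (fromℕ n)                      ≡⟨ sym (lookup-⊛ᵐ k (unit (fromℕ n)) (fromℕ n)) ⟩
        lookup (k ⊛ unit (fromℕ n)) (fromℕ n)                      ≤⟨ m≤n+m _ _ ⟩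
        lookup u (fromℕ n) + lookup (k ⊛ unit (fromℕ n)) (fromℕ n) ≡⟨ sym (lookup-⊕ u _ (fromℕ n)) ⟩
        lookup u′ (fromℕ n)                                        ∎
        where open ≤-Reasoning
      agree : ∀ j → rank j < rank (fromℕ n) → lookup u′ j ≡ lookup v j
      agree j j<n with j Fin.≟ fromℕ n
      ... | yes refl = ⊥-elim (<-irrefl refl j<n)
      ... | no  j≢n  = ⊥-elim (<-asym j<n (last-smallest j j≢n))

    standard-unique : ∀ {u v} → Standard u → Standard v → matVec A u ≡ matVec A v → u ≡ v
    standard-unique {u} {v} su sv eq with <-cmp (deg u) (deg v)
    ... | tri< du<dv _ _ = ⊥-elim (standard-deg≮ su sv eq du<dv)
    ... | tri≈ _ du≡dv _ = irreducible-unique (proj₂ su) (proj₂ sv) (eq , du≡dv)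
    ... | tri> _ _ dv<du = ⊥-elim (standard-deg≮ sv su (sym eq) dv<du)

    -- Erasing the last exponent of the least monomial of the fibre keeps the image, since that
    -- column is zero, and only shrinks the support, so irreducibility survives.
    standard-representative : ∀ u → ∃ λ v → Standard v × matVec A v ≡ matVec A u × deg v ≤ deg u
    standard-representative u with w , (Aw≡Au , dw≡du) , irr ← irreducible-representative u =
      v , (vₙ≡0 , irreducible-support K squarefree supp irr) , trans Av≡Aw Aw≡Au ,
      subst (deg v ≤_) dw≡du dv≤dw
      where
      wₙ = lookup w (fromℕ n)
      v = w Vec.[ fromℕ n ]≔ 0
      vₙ≡0 : lookup v (fromℕ n) ≡ 0
      vₙ≡0 = lookup∘update (fromℕ n) w 0
      w≡ : w ≡ v ⊕ (wₙ ⊛ unit (fromℕ n))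
      w≡ = lookup-ext λ i → sym (trans (lookup-⊕ v _ i) (trans (cong (lookup v i ℕ.+_) (lookup-⊛ᵐ wₙ (unit (fromℕ n)) i)) (at i)))
        where
        at : ∀ i → lookup v i + wₙ * lookup (unit (fromℕ n)) i ≡ lookup w i
        at i with i Fin.≟ fromℕ n
        ... | yes refl = trans (cong₂ (λ x y → x + wₙ * y) vₙ≡0 (lookup-unit (fromℕ n))) (*-identityʳ wₙ)
        ... | no i≢n = trans (cong₂ (λ x y → x + wₙ * y) (lookup∘update′ i≢n w 0) (lookup-unit′ (fromℕ n) i (i≢n ∘ sym)))
                             (trans (cong (lookup w i ℕ.+_) (*-zeroʳ wₙ)) (+-identityʳ _))
      Av≡Aw : matVec A v ≡ matVec A w
      Av≡Aw = trans (sym (matVec-⊕-last v wₙ)) (cong (matVec A) (sym w≡))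
      dv≤dw : deg v ≤ deg w
      dv≤dw = subst (deg v ≤_) (trans (sym (deg-⊕-last v wₙ)) (cong deg (sym w≡))) (m≤m+n (deg v) wₙ)
      supp : ∀ i → 0 < lookup v i → 0 < lookup w i
      supp i 0<vᵢ with i Fin.≟ fromℕ n
      ... | yes refl = ⊥-elim (<-irrefl refl (subst (0 <_) vₙ≡0 0<vᵢ))
      ... | no i≢n   = subst (0 <_) (lookup∘update′ i≢n w 0) 0<vᵢ

    standardMonomials : StandardMonomials A
    standardMonomials = record
      { Standard       = Standard
      ; support        = standard-support
      ; unique         = standard-unique
      ; representative = standard-representative
      }

open Toric

-- Normality from linearity on supports.

module AbstractNormality where
  open import Data.Nat using (_+_; _*_; _^_)
  open import Data.Nat.Properties
  open import Data.Fin using (toℕ; funToFin; finToFun)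
  open import Data.Fin.Properties using (pigeonhole; finToFun-funToFin)
  open import Algebra.Properties.Group (AbelianGroup.group ℤ.+-0-abelianGroup) using () renaming (∙-cancelˡ to ℤ-cancelˡ)

  sign : ℕ → Fin 2
  sign zero    = zero
  sign (suc _) = suc zero

  sign-positive : ∀ {x y} → sign x ≡ sign y → 0 < x → 0 < y
  sign-positive {suc x} {suc y} _ _ = s≤s z≤n

  module _ (f : ℕ → ℕ) where

    -- Sampling every `M` would give no lower bound on the gap between two values with equal
    -- support. Each leap exceeds `f` at the point it leaves, so every pair that the pigeonhole
    -- principle may return is far enough apart.
    leaps : ℕ → ℕ
    leaps zero    = 0
    leaps (suc j) = suc (leaps j + f (leaps j))

    leaps-mono : ∀ {i j} → i ≤ j → leaps i ≤ leaps j
    leaps-mono {i} {j} i≤j with ≤⇒≤′ i≤j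
    ... | ℕ.≤′-refl     = ≤-refl
    ... | ℕ.≤′-step i≤k = ≤-trans (leaps-mono (≤′⇒≤ i≤k)) (m≤n⇒m≤1+n (m≤m+n _ _))

    leaps-gap : ∀ {i j} → i < j → ∃ λ D → leaps j ≡ leaps i + D × f (leaps i) < D
    leaps-gap {i} {j} i<j = D , sym (m+[n∸m]≡n (leaps-mono (<⇒≤ i<j))) ,
      subst (_≤ D) (trans (cong (_∸ leaps i) (sym (+-suc (leaps i) _))) (m+n∸m≡n (leaps i) _)) (∸-monoˡ-≤ (leaps i) (leaps-mono i<j))
      where D = leaps j ∸ leaps i

    -- There are `2 ^ p` supports, so two of the first `2 ^ p + 1` leaps share one. Supports are
    -- encoded as functions into `Fin 2` so that `funToFin` numbers them.
    recurring-support : ∀ {p} (g : ℕ → Mon p) → ∃ λ M → ∃ λ D → f M < D ×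
      (∀ i → sign (lookup (g M) i) ≡ sign (lookup (g (M + D)) i))
    recurring-support {p} g
      with i , j , i<j , eq ← pigeonhole (n<1+n (2 ^ p)) (λ j → funToFin (λ i → sign (lookup (g (leaps (toℕ j))) i)))
      with D , gap , f<D ← leaps-gap i<j =
      leaps (toℕ i) , D , f<D , λ k → subst (λ M → _ ≡ sign (lookup (g M) k)) gap
        (trans (sym (finToFun-funToFin _ k)) (trans (cong (λ s → finToFun s k) eq) (finToFun-funToFin _ k)))

  module Normality {p d} (π : Mon p → Fin d → ℤ)
    (π-⊕ : ∀ u v i → π (u ⊕ v) i ≡ π u i ℤ.+ π v i)
    (π-⊛ : ∀ k u i → π (k ⊛ u) i ≡ + k ℤ.* π u i)
    (Std : Mon p → Set)
    (std-support : ∀ {u v} → (∀ i → 0 < lookup v i → 0 < lookup u i) → Std u → Std v)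
    (std-unique : ∀ {u v} → Std u → Std v → (∀ i → π u i ≡ π v i) → u ≡ v)
    (std-rep : ∀ u → ∃ λ v → Std v × (∀ i → π v i ≡ π u i))
    where

    module _ (z : Fin d → ℤ) (N : ℕ) (u s s′ : Mon p)
      (πu : ∀ i → π u i ≡ + suc N ℤ.* z i) (πs : ∀ i → π s i ≡ z i ℤ.+ π s′ i) where

      lower : ℕ → Mon p
      lower M = proj₁ (std-rep ((M ⊛ u) ⊕ s′))

      lower-std : ∀ M → Std (lower M)
      lower-std M = proj₁ (proj₂ (std-rep ((M ⊛ u) ⊕ s′)))

      π-affine : ∀ M r i → π ((M ⊛ u) ⊕ r) i ≡ + M ℤ.* (+ suc N ℤ.* z i) ℤ.+ π r i
      π-affine M r i = trans (π-⊕ (M ⊛ u) r i) (cong (ℤ._+ π r i) (trans (π-⊛ M u i) (cong (+ M ℤ.*_) (πu i))))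

      π-lower : ∀ M i → π (lower M) i ≡ + M ℤ.* (+ suc N ℤ.* z i) ℤ.+ π s′ i
      π-lower M i = trans (proj₂ (proj₂ (std-rep ((M ⊛ u) ⊕ s′))) i) (π-affine M s′ i)

      -- The images of `γ` and `g₁` differ by `z`, so the only question is whether `g₁` divides `γ`.
      -- The quotient is then standard because its support lies in that of `γ`.
      normality : ∃ λ v → Std v × (∀ i → π v i ≡ z i)
      normality with M , D , deg<D , same ← recurring-support (λ M → deg (lower M)) lower
        with suc D′ ← D
        with γ , γ-std , πγ ← std-rep ((M ⊛ u) ⊕ s) =
        β , std-support β⊆γ γ-std , πβ
        where
        g₁ = lower M
        g₂ = lower (M + suc D′)
        -- With `D = suc D′`, this is `(N + 1) D - 1`; `suc P′` unfolds to the product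
        -- `suc N * suc D′`.
        P′ = D′ + N * suc D′
        β = zipWith _∸_ γ g₁

        supp-combination : ∀ i → 0 < lookup ((P′ ⊛ g₁) ⊕ g₂) i → 0 < lookup g₁ i
        supp-combination i 0<x with lookup g₁ i in g₁ᵢ | lookup g₂ i in g₂ᵢ
        ... | suc _ | _     = s≤s z≤n
        ... | zero  | suc y = sign-positive {x = suc y} (trans (cong sign (sym g₂ᵢ)) (trans (sym (same i)) (cong sign g₁ᵢ))) (s≤s z≤n)
        ... | zero  | zero  = ⊥-elim (<-irrefl refl (subst (0 <_) (begin
          lookup ((P′ ⊛ g₁) ⊕ g₂) i          ≡⟨ lookup-⊕ (P′ ⊛ g₁) g₂ i ⟩
          lookup (P′ ⊛ g₁) i + lookup g₂ i   ≡⟨ cong₂ _+_ (trans (lookup-⊛ᵐ P′ g₁ i) (cong (P′ *_) g₁ᵢ)) g₂ᵢ ⟩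
          P′ * 0 + 0                         ≡⟨ cong (_+ 0) (*-zeroʳ P′) ⟩
          0                                  ∎) 0<x))
          where open ≡-Reasoning

        -- Both sides are standard for reasons of support: the left uses only variables of `γ`, the
        -- right only those of `g₁`, because `g₂` brings no new ones. The images agree since
        -- `suc P′` copies of `z` on the left match the `D` extra copies of `(N + 1) z` hidden in
        -- `g₂`.
        balance : suc P′ ⊛ γ ≡ (P′ ⊛ g₁) ⊕ g₂
        balance = std-unique (std-support (⊛-support (suc P′) γ) γ-std) (std-support supp-combination (lower-std M)) λ i → begin
          π (suc P′ ⊛ γ) i                                  ≡⟨ π-⊛ (suc P′) γ i ⟩
          + suc P′ ℤ.* π γ i                                ≡⟨ cong (+ suc P′ ℤ.*_) (trans (πγ i) (trans (π-affine M s i) (cong (λ q → m ℤ.* (k ℤ.* z i) ℤ.+ q) (πs i)))) ⟩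
          + suc P′ ℤ.* (m ℤ.* (k ℤ.* z i) ℤ.+ (z i ℤ.+ π s′ i))
            ≡⟨ cong (λ q → q ℤ.* (m ℤ.* (k ℤ.* z i) ℤ.+ (z i ℤ.+ π s′ i))) (ℤ.pos-* (suc N) (suc D′)) ⟩
          k ℤ.* δ ℤ.* (m ℤ.* (k ℤ.* z i) ℤ.+ (z i ℤ.+ π s′ i)) ≡⟨ arith k δ m (z i) (π s′ i) ⟩
          (k ℤ.* δ ℤ.- + 1) ℤ.* (m ℤ.* (k ℤ.* z i) ℤ.+ π s′ i) ℤ.+ ((m ℤ.+ δ) ℤ.* (k ℤ.* z i) ℤ.+ π s′ i)
            ≡⟨ cong (λ q → q ℤ.* (m ℤ.* (k ℤ.* z i) ℤ.+ π s′ i) ℤ.+ ((m ℤ.+ δ) ℤ.* (k ℤ.* z i) ℤ.+ π s′ i)) (cong (ℤ._- + 1) (sym (ℤ.pos-* (suc N) (suc D′)))) ⟩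
          + P′ ℤ.* (m ℤ.* (k ℤ.* z i) ℤ.+ π s′ i) ℤ.+ (+ (M + suc D′) ℤ.* (k ℤ.* z i) ℤ.+ π s′ i)
            ≡⟨ sym (cong₂ (λ x y → + P′ ℤ.* x ℤ.+ y) (π-lower M i) (π-lower (M + suc D′) i)) ⟩
          + P′ ℤ.* π g₁ i ℤ.+ π g₂ i                        ≡⟨ cong (ℤ._+ π g₂ i) (sym (π-⊛ P′ g₁ i)) ⟩
          π (P′ ⊛ g₁) i ℤ.+ π g₂ i                          ≡⟨ sym (π-⊕ (P′ ⊛ g₁) g₂ i) ⟩
          π ((P′ ⊛ g₁) ⊕ g₂) i                              ∎
          where
          open ≡-Reasoning
          k = + suc N
          δ = + suc D′
          m = + M
          arith : ∀ k δ m z σ → k ℤ.* δ ℤ.* (m ℤ.* (k ℤ.* z) ℤ.+ (z ℤ.+ σ)) ≡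
            (k ℤ.* δ ℤ.- + 1) ℤ.* (m ℤ.* (k ℤ.* z) ℤ.+ σ) ℤ.+ ((m ℤ.+ δ) ℤ.* (k ℤ.* z) ℤ.+ σ)
          arith = solve 5 (λ k δ m z σ → k :* δ :* (m :* (k :* z) :+ (z :+ σ)) :=
            (k :* δ :- con (+ 1)) :* (m :* (k :* z) :+ σ) :+ ((m :+ δ) :* (k :* z) :+ σ)) refl
            where open ℤSolver.+-*-Solver

        -- If an entry of `g₁` were larger than that of `γ`, dropping `g₂` from `balance` would
        -- force this entry to be at least `(N + 1) D`, whereas the degree of `g₁` is less than `D`.
        g₁≤γ : Divides g₁ γ
        g₁≤γ i = ≮⇒≥ λ γ<g₁ → <⇒≱ small (+-cancelˡ-≤ (P′ * lookup g₁ i) _ _ (begin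
          P′ * lookup g₁ i + suc P′                   ≤⟨ +-monoˡ-≤ (suc P′) (m≤m+n _ (lookup g₂ i)) ⟩
          (P′ * lookup g₁ i + lookup g₂ i) + suc P′   ≡⟨ cong (λ x → x + lookup g₂ i + suc P′) (sym (lookup-⊛ᵐ P′ g₁ i)) ⟩
          (lookup (P′ ⊛ g₁) i + lookup g₂ i) + suc P′ ≡⟨ cong (_+ suc P′) (sym (lookup-⊕ (P′ ⊛ g₁) g₂ i)) ⟩
          lookup ((P′ ⊛ g₁) ⊕ g₂) i + suc P′          ≡⟨ cong (λ w → lookup w i + suc P′) (sym balance) ⟩
          lookup (suc P′ ⊛ γ) i + suc P′              ≡⟨ cong (_+ suc P′) (lookup-⊛ᵐ (suc P′) γ i) ⟩
          suc P′ * lookup γ i + suc P′                ≡⟨ trans (+-comm _ (suc P′)) (sym (*-suc (suc P′) (lookup γ i))) ⟩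
          suc P′ * suc (lookup γ i)                   ≤⟨ *-monoʳ-≤ (suc P′) γ<g₁ ⟩
          suc P′ * lookup g₁ i                        ≡⟨ +-comm (lookup g₁ i) _ ⟩
          P′ * lookup g₁ i + lookup g₁ i              ∎))
          where
          open ≤-Reasoning
          small : lookup g₁ i < suc P′
          small = ≤-trans (≤-trans (s≤s (lookup≤deg g₁ i)) deg<D) (s≤s (m≤m+n D′ _))

        β⊆γ : ∀ i → 0 < lookup β i → 0 < lookup γ i
        β⊆γ i 0<β = ≤-trans 0<β (subst (_≤ lookup γ i) (sym (lookup-zipWith _∸_ i γ g₁)) (m∸n≤m _ (lookup g₁ i)))

        πβ : ∀ i → π β i ≡ z i
        πβ i = ℤ-cancelˡ (π g₁ i) _ _ (begin
          π g₁ i ℤ.+ π β i                            ≡⟨ sym (π-⊕ g₁ β i) ⟩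
          π (g₁ ⊕ β) i                                ≡⟨ cong (λ w → π w i) (sym (divides⇒⊕ g₁≤γ)) ⟩
          π γ i                                       ≡⟨ trans (πγ i) (trans (π-affine M s i) (cong (λ q → t ℤ.+ q) (πs i))) ⟩
          t ℤ.+ (z i ℤ.+ π s′ i)                      ≡⟨ cong (λ q → t ℤ.+ q) (ℤ.+-comm (z i) (π s′ i)) ⟩
          t ℤ.+ (π s′ i ℤ.+ z i)                      ≡⟨ sym (ℤ.+-assoc t _ _) ⟩
          (t ℤ.+ π s′ i) ℤ.+ z i                      ≡⟨ cong (ℤ._+ z i) (sym (π-lower M i)) ⟩
          π g₁ i ℤ.+ z i                              ∎)
          where
          open ≡-Reasoning
          t = + M ℤ.* (+ suc N ℤ.* z i)

open AbstractNormality

-- Standard pairs for two configurations of harmony.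

module TwoConfigurations where
  open import Data.Nat using (_+_; _*_)
  open import Data.Nat.Properties
  open import Data.Fin using (_↑ˡ_; _↑ʳ_)
  open import Data.Fin.Properties using (any?)
  open import Data.Vec using (take; drop; _++_)
  open import Data.Vec.Membership.Propositional.Properties using (∈-lookup)
  open import Data.Vec.Relation.Unary.Any using (index)
  open import Data.Vec.Relation.Unary.Any.Properties using (lookup-index)

  deg-mono : ∀ {n} {u v : Mon n} → Divides u v → deg u ≤ deg v
  deg-mono {u = []}    {[]}    _ = z≤n
  deg-mono {u = x ∷ u} {y ∷ v} h = +-mono-≤ (h zero) (deg-mono {u = u} {v} (λ i → h (suc i)))

  deg-strict : ∀ {n} {u v : Mon n} → Divides u v → ∀ i → lookup u i < lookup v i → deg u < deg v
  deg-strict {u = x ∷ u} {y ∷ v} h zero    lt = +-mono-<-≤ lt (deg-mono {u = u} {v} (λ i → h (suc i)))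
  deg-strict {u = x ∷ u} {y ∷ v} h (suc i) lt = +-mono-≤-< (h zero) (deg-strict {u = u} {v} (λ i → h (suc i)) i lt)

  ∸-swap : ∀ x y → (x ∸ y) + y ≡ x + (y ∸ x)
  ∸-swap x       zero    = cong (λ q → x + q) (sym (0∸n≡0 x))
  ∸-swap zero    (suc y) = refl
  ∸-swap (suc x) (suc y) = trans (+-suc (x ∸ y) y) (cong suc (∸-swap x y))

  ∸-decreasing : ∀ {x y} → 0 < x → 0 < y → x ∸ y < x
  ∸-decreasing {suc x} {suc y} _ _ = s≤s (m∸n≤m x y)

  Disjoint : ∀ {d} → Mon d → Mon d → Set
  Disjoint x y = ∀ i → lookup x i ≡ 0 ⊎ lookup y i ≡ 0

  take-++ : ∀ {m n} (u : Mon m) (v : Mon n) → take m (u ++ v) ≡ u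
  take-++ {m} u v = ++-injectiveˡ (take m (u ++ v)) u (take++drop≡id m (u ++ v))

  drop-++ : ∀ {m n} (u : Mon m) (v : Mon n) → drop m (u ++ v) ≡ v
  drop-++ {m} u v = ++-injectiveʳ (take m (u ++ v)) u (take++drop≡id m (u ++ v))

  lookup-take : ∀ m {n} (w : Mon (m ℕ.+ n)) i → lookup (take m w) i ≡ lookup w (i ↑ˡ n)
  lookup-take m w i = trans (sym (lookup-++ˡ (take m w) (drop m w) i)) (cong (λ x → lookup x _) (take++drop≡id m w))

  lookup-drop : ∀ m {n} (w : Mon (m ℕ.+ n)) i → lookup (drop m w) i ≡ lookup w (m ↑ʳ i)
  lookup-drop m w i = trans (sym (lookup-++ʳ (take m w) (drop m w) i)) (cong (λ x → lookup x _) (take++drop≡id m w))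

  module Signed {d n m} (A : Vec (Vec ℕ d) n) (B : Vec (Vec ℕ d) m) where

    ⟦_,_⟧ : Mon n → Mon m → Fin d → ℤ
    ⟦ u , v ⟧ i = + lookup (matVec A u) i ℤ.- + lookup (matVec B v) i

    ⟦⟧-⊕ : ∀ u v u′ v′ i → ⟦ u ⊕ u′ , v ⊕ v′ ⟧ i ≡ ⟦ u , v ⟧ i ℤ.+ ⟦ u′ , v′ ⟧ i
    ⟦⟧-⊕ u v u′ v′ i
      rewrite matVec-⊕ A u u′ | lookup-⊕ (matVec A u) (matVec A u′) i
            | matVec-⊕ B v v′ | lookup-⊕ (matVec B v) (matVec B v′) i =
      solve 4 (λ a b a′ b′ → (a :+ a′) :- (b :+ b′) := (a :- b) :+ (a′ :- b′)) refl
        (+ lookup (matVec A u) i) (+ lookup (matVec B v) i) (+ lookup (matVec A u′) i) (+ lookup (matVec B v′) i)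
      where open ℤSolver.+-*-Solver

    ⟦⟧-⊛ : ∀ k u v i → ⟦ k ⊛ u , k ⊛ v ⟧ i ≡ + k ℤ.* ⟦ u , v ⟧ i
    ⟦⟧-⊛ k u v i
      rewrite matVec-⊛ A k u | lookup-⊛ᵐ k (matVec A u) i | matVec-⊛ B k v | lookup-⊛ᵐ k (matVec B v) i
            | ℤ.pos-* k (lookup (matVec A u) i) | ℤ.pos-* k (lookup (matVec B v) i) =
      solve 3 (λ k a b → k :* a :- k :* b := k :* (a :- b)) refl (+ k) (+ lookup (matVec A u) i) (+ lookup (matVec B v) i)
      where open ℤSolver.+-*-Solver

    difference-≡ : ∀ a b a′ b′ → + a ℤ.- + b ≡ + a′ ℤ.- + b′ → a + b′ ≡ a′ + b
    difference-≡ a b a′ b′ eq = ℤ.+-injective (begin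
      + a ℤ.+ + b′                            ≡⟨ shuffle (+ a) (+ b) (+ b′) ⟩
      (+ a ℤ.- + b) ℤ.+ (+ b ℤ.+ + b′)        ≡⟨ cong (ℤ._+ (+ b ℤ.+ + b′)) eq ⟩
      (+ a′ ℤ.- + b′) ℤ.+ (+ b ℤ.+ + b′)      ≡⟨ cong (λ q → (+ a′ ℤ.- + b′) ℤ.+ q) (ℤ.+-comm (+ b) (+ b′)) ⟩
      (+ a′ ℤ.- + b′) ℤ.+ (+ b′ ℤ.+ + b)      ≡⟨ sym (shuffle (+ a′) (+ b′) (+ b)) ⟩
      + a′ ℤ.+ + b                            ∎)
      where
      open ≡-Reasoning
      open ℤSolver.+-*-Solver
      shuffle : ∀ x y z → x ℤ.+ z ≡ (x ℤ.- y) ℤ.+ (y ℤ.+ z)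
      shuffle = solve 3 (λ x y z → x :+ z := (x :- y) :+ (y :+ z)) refl

    ≡-difference : ∀ a b a′ b′ → a + b′ ≡ a′ + b → + a ℤ.- + b ≡ + a′ ℤ.- + b′
    ≡-difference a b a′ b′ eq = begin
      + a ℤ.- + b                                ≡⟨ shuffle (+ a) (+ b) (+ b′) ⟩
      (+ a ℤ.+ + b′) ℤ.- (+ b ℤ.+ + b′)          ≡⟨ cong (ℤ._- (+ b ℤ.+ + b′)) (cong +_ eq) ⟩
      (+ a′ ℤ.+ + b) ℤ.- (+ b ℤ.+ + b′)          ≡⟨ cong (λ q → (+ a′ ℤ.+ + b) ℤ.- q) (ℤ.+-comm (+ b) (+ b′)) ⟩
      (+ a′ ℤ.+ + b) ℤ.- (+ b′ ℤ.+ + b)          ≡⟨ sym (shuffle (+ a′) (+ b′) (+ b)) ⟩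
      + a′ ℤ.- + b′                              ∎
      where
      open ≡-Reasoning
      open ℤSolver.+-*-Solver
      shuffle : ∀ x y z → x ℤ.- y ≡ (x ℤ.+ z) ℤ.- (y ℤ.+ z)
      shuffle = solve 3 (λ x y z → x :- y := (x :+ z) :- (y :+ z)) refl

    module _ (harmony : Harmony A B) where

      record Cancelled (u : Mon n) (v : Mon m) : Set where
        field
          u′      : Mon n
          v′      : Mon m
          deg-u′  : deg u′ ≡ deg u
          deg-v′  : deg v′ ≡ deg v
          balance : ∀ i → ⟦ u′ , v′ ⟧ i ≡ ⟦ u , v ⟧ i

      -- A column a of A and a column b of B that overlap are traded for a ∸ b and b ∸ a.
      cancel-once : ∀ u v i → 0 < lookup (matVec A u) i → 0 < lookup (matVec B v) i →
        Σ (Cancelled u v) λ c → deg (matVec A (Cancelled.u′ c)) < deg (matVec A u)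
      cancel-once u v i 0<Au 0<Bv
        with j , 0<uⱼ , 0<a ← matVec-positive⁻ A u i 0<Au
        with k , 0<vₖ , 0<b ← matVec-positive⁻ B v i 0<Bv
        with u₀ , refl ← positive⇒unit u j 0<uⱼ
        with v₀ , refl ← positive⇒unit v k 0<vₖ
        with a∸b∈A , b∸a∈B ← proj₂ (proj₂ harmony) (lookup A j) (lookup B k) (∈-lookup j A) (∈-lookup k B) =
        record
          { u′ = unit j′ ⊕ u₀
          ; v′ = unit k′ ⊕ v₀
          ; deg-u′ = trans (deg-swap j′ u₀) (sym (deg-swap j u₀))
          ; deg-v′ = trans (deg-swap k′ v₀) (sym (deg-swap k v₀))
          ; balance = λ i → ≡-difference (lookup (matVec A (unit j′ ⊕ u₀)) i) _ (lookup (matVec A (unit j ⊕ u₀)) i) _ (at i)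
          } , smaller
        where
        a = lookup A j
        b = lookup B k
        j′ = index a∸b∈A
        k′ = index b∸a∈B
        deg-swap : ∀ {n} (j : Fin n) u → deg (unit j ⊕ u) ≡ suc (deg u)
        deg-swap j u = trans (deg-⊕ (unit j) u) (cong (_+ deg u) (deg-unit j))
        A-swap : ∀ j → matVec A (unit j ⊕ u₀) ≡ lookup A j ⊕ matVec A u₀
        A-swap j = trans (matVec-⊕ A (unit j) u₀) (cong (_⊕ matVec A u₀) (matVec-unit A j))
        B-swap : ∀ j → matVec B (unit j ⊕ v₀) ≡ lookup B j ⊕ matVec B v₀
        B-swap j = trans (matVec-⊕ B (unit j) v₀) (cong (_⊕ matVec B v₀) (matVec-unit B j))
        Aj′ : matVec A (unit j′ ⊕ u₀) ≡ zipWith _∸_ a b ⊕ matVec A u₀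
        Aj′ = trans (A-swap j′) (cong (_⊕ matVec A u₀) (sym (lookup-index a∸b∈A)))
        Bk′ : matVec B (unit k′ ⊕ v₀) ≡ zipWith _∸_ b a ⊕ matVec B v₀
        Bk′ = trans (B-swap k′) (cong (_⊕ matVec B v₀) (sym (lookup-index b∸a∈B)))
        swap : zipWith _∸_ a b ⊕ b ≡ a ⊕ zipWith _∸_ b a
        swap = lookup-ext λ i → begin
          lookup (zipWith _∸_ a b ⊕ b) i             ≡⟨ lookup-⊕ (zipWith _∸_ a b) b i ⟩
          lookup (zipWith _∸_ a b) i + lookup b i    ≡⟨ cong (_+ lookup b i) (lookup-zipWith _∸_ i a b) ⟩
          (lookup a i ∸ lookup b i) + lookup b i     ≡⟨ ∸-swap (lookup a i) (lookup b i) ⟩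
          lookup a i + (lookup b i ∸ lookup a i)     ≡⟨ cong (λ q → lookup a i + q) (sym (lookup-zipWith _∸_ i b a)) ⟩
          lookup a i + lookup (zipWith _∸_ b a) i    ≡⟨ sym (lookup-⊕ a (zipWith _∸_ b a) i) ⟩
          lookup (a ⊕ zipWith _∸_ b a) i             ∎
          where open ≡-Reasoning
        balance : matVec A (unit j′ ⊕ u₀) ⊕ matVec B (unit k ⊕ v₀) ≡ matVec A (unit j ⊕ u₀) ⊕ matVec B (unit k′ ⊕ v₀)
        balance = begin
          matVec A (unit j′ ⊕ u₀) ⊕ matVec B (unit k ⊕ v₀)               ≡⟨ cong₂ _⊕_ Aj′ (B-swap k) ⟩
          (zipWith _∸_ a b ⊕ matVec A u₀) ⊕ (b ⊕ matVec B v₀)            ≡⟨ ⊕-interchange (zipWith _∸_ a b) _ _ _ ⟩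
          (zipWith _∸_ a b ⊕ b) ⊕ (matVec A u₀ ⊕ matVec B v₀)            ≡⟨ cong (_⊕ _) swap ⟩
          (a ⊕ zipWith _∸_ b a) ⊕ (matVec A u₀ ⊕ matVec B v₀)            ≡⟨ ⊕-interchange a _ _ _ ⟩
          (a ⊕ matVec A u₀) ⊕ (zipWith _∸_ b a ⊕ matVec B v₀)            ≡⟨ sym (cong₂ _⊕_ (A-swap j) Bk′) ⟩
          matVec A (unit j ⊕ u₀) ⊕ matVec B (unit k′ ⊕ v₀)               ∎
          where open ≡-Reasoning
        at : ∀ i → lookup (matVec A (unit j′ ⊕ u₀)) i + lookup (matVec B (unit k ⊕ v₀)) i ≡
                   lookup (matVec A (unit j ⊕ u₀)) i + lookup (matVec B (unit k′ ⊕ v₀)) i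
        at i = trans (sym (lookup-⊕ (matVec A (unit j′ ⊕ u₀)) _ i))
          (trans (cong (λ w → lookup w i) balance) (lookup-⊕ (matVec A (unit j ⊕ u₀)) _ i))
        a∸b≤a : Divides (zipWith _∸_ a b) a
        a∸b≤a i = subst (_≤ lookup a i) (sym (lookup-zipWith _∸_ i a b)) (m∸n≤m _ (lookup b i))
        a∸b<a : lookup (zipWith _∸_ a b) i < lookup a i
        a∸b<a = subst (_< lookup a i) (sym (lookup-zipWith _∸_ i a b)) (∸-decreasing 0<a 0<b)
        smaller : deg (matVec A (unit j′ ⊕ u₀)) < deg (matVec A (unit j ⊕ u₀))
        smaller = subst₂ _<_
          (trans (sym (deg-⊕ (zipWith _∸_ a b) (matVec A u₀))) (cong deg (sym Aj′)))
          (trans (sym (deg-⊕ a (matVec A u₀))) (cong deg (sym (A-swap j))))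
          (+-monoˡ-< (deg (matVec A u₀)) (deg-strict {u = zipWith _∸_ a b} {a} a∸b≤a i a∸b<a))

      -- Every trade preserves the difference and both degrees while lowering the sum of the entries
      -- of `A u`, so trading stops, and it stops only when no coordinate is positive on both sides.
      cancel : ∀ u v → Acc _<_ (deg (matVec A u)) →
        Σ (Cancelled u v) λ c → Disjoint (matVec A (Cancelled.u′ c)) (matVec B (Cancelled.v′ c))
      cancel u v (acc rec) with any? (λ i → (0 ℕ.<? lookup (matVec A u) i) ×-dec (0 ℕ.<? lookup (matVec B v) i))
      ... | no none = record { u′ = u ; v′ = v ; deg-u′ = refl ; deg-v′ = refl ; balance = λ _ → refl } , disjoint
        where
        disjoint : Disjoint (matVec A u) (matVec B v)
        disjoint i with lookup (matVec A u) i in eqA | lookup (matVec B v) i in eqB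
        ... | zero  | _     = inj₁ refl
        ... | suc _ | zero  = inj₂ refl
        ... | suc _ | suc _ = ⊥-elim (none (i , subst (0 <_) (sym eqA) (s≤s z≤n) , subst (0 <_) (sym eqB) (s≤s z≤n)))
      ... | yes (i , 0<Au , 0<Bv)
        with c , smaller ← cancel-once u v i 0<Au 0<Bv
        with c′ , disjoint ← cancel (Cancelled.u′ c) (Cancelled.v′ c) (rec smaller) =
        record
          { u′ = C′.u′
          ; v′ = C′.v′
          ; deg-u′ = trans C′.deg-u′ C.deg-u′
          ; deg-v′ = trans C′.deg-v′ C.deg-v′
          ; balance = λ i → trans (C′.balance i) (C.balance i)
          } , disjoint
        where
        module C = Cancelled c
        module C′ = Cancelled c′

      cancelled : ∀ u v → Σ (Cancelled u v) λ c → Disjoint (matVec A (Cancelled.u′ c)) (matVec B (Cancelled.v′ c))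
      cancelled u v = cancel u v (<-wellFounded _)

      module _ (SA : StandardMonomials A) (SB : StandardMonomials B) where
        private
          module SA = StandardMonomials SA
          module SB = StandardMonomials SB

        Std : Mon n → Mon m → Set
        Std u v = SA.Standard u × SB.Standard v × Disjoint (matVec A u) (matVec B v)

        matVec-support : ∀ {d n} (A : Vec (Vec ℕ d) n) {u v} → (∀ i → 0 < lookup v i → 0 < lookup u i) →
          ∀ i → lookup (matVec A u) i ≡ 0 → lookup (matVec A v) i ≡ 0
        matVec-support A {u} {v} supp i Au≡0 with lookup (matVec A v) i in eq
        ... | zero  = refl
        ... | suc _ with j , 0<vⱼ , 0<aⱼ ← matVec-positive⁻ A v i (subst (0 <_) (sym eq) (s≤s z≤n)) =
          ⊥-elim (<-irrefl refl (subst (0 <_) Au≡0 (matVec-positive⁺ A u i j (supp j 0<vⱼ) 0<aⱼ)))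

        std-support : ∀ {u v u′ v′} → (∀ i → 0 < lookup u′ i → 0 < lookup u i) →
          (∀ i → 0 < lookup v′ i → 0 < lookup v i) → Std u v → Std u′ v′
        std-support {u} {v} {u′} {v′} suppA suppB (su , sv , disjoint) =
          SA.support suppA su , SB.support suppB sv , disjoint′
          where
          disjoint′ : Disjoint (matVec A u′) (matVec B v′)
          disjoint′ i with disjoint i
          ... | inj₁ z = inj₁ (matVec-support A suppA i z)
          ... | inj₂ z = inj₂ (matVec-support B suppB i z)

        disjoint-parts : ∀ {a b a′ b′} → a ≡ 0 ⊎ b ≡ 0 → a′ ≡ 0 ⊎ b′ ≡ 0 → a + b′ ≡ a′ + b → a ≡ a′ × b ≡ b′
        disjoint-parts {a′ = a′} (inj₁ refl) (inj₁ refl) eq = refl , sym eq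
        disjoint-parts {b = b} {a′} (inj₁ refl) (inj₂ refl) eq
          with refl ← m+n≡0⇒m≡0 a′ (sym eq) = refl , sym eq
        disjoint-parts {a} {b′ = b′} (inj₂ refl) (inj₁ refl) eq
          with refl ← m+n≡0⇒m≡0 a eq = refl , sym eq
        disjoint-parts {a} {a′ = a′} (inj₂ refl) (inj₂ refl) eq =
          trans (sym (+-identityʳ a)) (trans eq (+-identityʳ a′)) , refl

        -- Nonnegative vectors with disjoint supports are the positive and the negative part of
        -- their difference. The difference thus determines both images, and each image its standard
        -- monomial.
        std-unique : ∀ {u v u′ v′} → Std u v → Std u′ v′ → (∀ i → ⟦ u , v ⟧ i ≡ ⟦ u′ , v′ ⟧ i) → u ≡ u′ × v ≡ v′
        std-unique {u} {v} {u′} {v′} (su , sv , dis) (su′ , sv′ , dis′) eq =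
          SA.unique su su′ (lookup-ext λ i → proj₁ (parts i)) , SB.unique sv sv′ (lookup-ext λ i → proj₂ (parts i))
          where parts = λ i → disjoint-parts (dis i) (dis′ i) (difference-≡ (lookup (matVec A u) i) _ (lookup (matVec A u′) i) _ (eq i))

        -- Cancellation has to come first, since it need not preserve standardness. Passing to
        -- standard representatives afterwards leaves both images untouched, and with them the
        -- disjointness.
        std-rep : ∀ u v → ∃ λ u′ → ∃ λ v′ → Std u′ v′ × (∀ i → ⟦ u′ , v′ ⟧ i ≡ ⟦ u , v ⟧ i) × deg u′ ≤ deg u × deg v′ ≤ deg v
        std-rep u v
          with c , disjoint ← cancelled u v
          with u″ , su , Au″ , du ← SA.representative (Cancelled.u′ c)
          with v″ , sv , Bv″ , dv ← SB.representative (Cancelled.v′ c) =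
          u″ , v″ , (su , sv , subst₂ Disjoint (sym Au″) (sym Bv″) disjoint) ,
          (λ i → trans (cong₂ (λ x y → + lookup x i ℤ.- + lookup y i) Au″ Bv″) (Cancelled.balance c i)) ,
          ≤-trans du (≤-reflexive (Cancelled.deg-u′ c)) , ≤-trans dv (≤-reflexive (Cancelled.deg-v′ c))

        private
          -- Pairs are read off one concatenated exponent vector, so that a single pigeonhole makes
          -- both supports recur at the same `M` and `M + D`.
          πʲ : Mon (n + m) → Fin d → ℤ
          πʲ w = ⟦ take n w , drop n w ⟧

          πʲ-⊕ : ∀ w w′ i → πʲ (w ⊕ w′) i ≡ πʲ w i ℤ.+ πʲ w′ i
          πʲ-⊕ w w′ i = trans (cong₂ (λ x y → ⟦ x , y ⟧ i) (take-zipWith {m = n} _+_ w w′) (drop-zipWith {m = n} _+_ w w′))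
            (⟦⟧-⊕ (take n w) (drop n w) _ _ i)

          πʲ-⊛ : ∀ k w i → πʲ (k ⊛ w) i ≡ + k ℤ.* πʲ w i
          πʲ-⊛ k w i = trans (cong₂ (λ x y → ⟦ x , y ⟧ i) (take-map (k *_) n w) (drop-map (k *_) n w))
            (⟦⟧-⊛ k (take n w) (drop n w) i)

          Stdʲ : Mon (n + m) → Set
          Stdʲ w = Std (take n w) (drop n w)

          stdʲ-support : ∀ {w w′} → (∀ i → 0 < lookup w′ i → 0 < lookup w i) → Stdʲ w → Stdʲ w′
          stdʲ-support {w} {w′} supp = std-support
            (λ i 0<w → subst (0 <_) (sym (lookup-take n w i)) (supp _ (subst (0 <_) (lookup-take n w′ i) 0<w)))
            (λ i 0<w → subst (0 <_) (sym (lookup-drop n w i)) (supp _ (subst (0 <_) (lookup-drop n w′ i) 0<w)))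

          stdʲ-unique : ∀ {w w′} → Stdʲ w → Stdʲ w′ → (∀ i → πʲ w i ≡ πʲ w′ i) → w ≡ w′
          stdʲ-unique {w} {w′} sw sw′ eq = let p , q = std-unique sw sw′ eq in
            trans (sym (take++drop≡id n w)) (trans (cong₂ _++_ p q) (take++drop≡id n w′))

          stdʲ-rep : ∀ w → ∃ λ w′ → Stdʲ w′ × (∀ i → πʲ w′ i ≡ πʲ w i)
          stdʲ-rep w = let u , v , s , eq , _ = std-rep (take n w) (drop n w) in
            u ++ v , subst₂ Std (sym (take-++ u v)) (sym (drop-++ u v)) s ,
            λ i → trans (cong₂ (λ x y → ⟦ x , y ⟧ i) (take-++ u v) (drop-++ u v)) (eq i)

        module N = Normality πʲ πʲ-⊕ πʲ-⊛ Stdʲ stdʲ-support stdʲ-unique stdʲ-rep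

        Rank : Vec ℤ d → ℕ → ℕ → Set
        Rank z α β = ∃ λ u → ∃ λ v → Std u v × (∀ i → ⟦ u , v ⟧ i ≡ lookup z i) × deg u ≡ α × deg v ≡ β

        rank-unique : ∀ {z α β α′ β′} → Rank z α β → Rank z α′ β′ → α ≡ α′ × β ≡ β′
        rank-unique (u , v , s , eq , refl , refl) (u′ , v′ , s′ , eq′ , refl , refl)
          with refl , refl ← std-unique s s′ (λ i → trans (eq i) (sym (eq′ i))) = refl , refl

        -- Multiplying the pair of `z` by `N + 1` keeps its supports, so the result is the standard
        -- pair of `(N + 1) z`, whose degrees do not exceed those of `u` and `v`. This passes from
        -- rational weights to integral degrees, on each side separately.
        rank-of-multiple : ∀ z N u v s t s′ t′ → (∀ i → ⟦ u , v ⟧ i ≡ + suc N ℤ.* lookup z i) →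
          (∀ i → ⟦ s , t ⟧ i ≡ lookup z i ℤ.+ ⟦ s′ , t′ ⟧ i) →
          ∃ λ α → ∃ λ β → Rank z α β × suc N * α ≤ deg u × suc N * β ≤ deg v
        rank-of-multiple z N u v s t s′ t′ multiple lattice = from (std-rep u v)
          (N.normality (lookup z) N (u ++ v) (s ++ t) (s′ ++ t′)
            (λ i → trans (cong₂ (λ x y → ⟦ x , y ⟧ i) (take-++ u v) (drop-++ u v)) (multiple i))
            (λ i → trans (cong₂ (λ x y → ⟦ x , y ⟧ i) (take-++ s t) (drop-++ s t)) (trans (lattice i)
              (cong (λ q → lookup z i ℤ.+ q) (sym (cong₂ (λ x y → ⟦ x , y ⟧ i) (take-++ s′ t′) (drop-++ s′ t′)))))))
          where
          scaled-deg : ∀ {p} {x u′ : Mon p} {e} → suc N ⊛ x ≡ u′ → deg u′ ≤ e → suc N * deg x ≤ e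
          scaled-deg {x = x} refl = ≤-trans (≤-reflexive (sym (deg-⊛ (suc N) x)))
          from : (∃ λ u′ → ∃ λ v′ → Std u′ v′ × (∀ i → ⟦ u′ , v′ ⟧ i ≡ ⟦ u , v ⟧ i) × deg u′ ≤ deg u × deg v′ ≤ deg v) →
            (∃ λ w → Std (take n w) (drop n w) × (∀ i → ⟦ take n w , drop n w ⟧ i ≡ lookup z i)) →
            ∃ λ α → ∃ λ β → Rank z α β × suc N * α ≤ deg u × suc N * β ≤ deg v
          from (u′ , v′ , std′ , eq′ , du , dv) (w , std , eq) =
            deg x , deg y , (x , y , std , eq , refl , refl) ,
            scaled-deg (proj₁ same) du , scaled-deg (proj₂ same) dv
            where
            x = take n w
            y = drop n w
            same : suc N ⊛ x ≡ u′ × suc N ⊛ y ≡ v′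
            same = std-unique (std-support (⊛-support (suc N) x) (⊛-support (suc N) y) std) std′
              λ i → trans (⟦⟧-⊛ (suc N) x y i) (trans (cong (+ suc N ℤ.*_) (eq i)) (trans (sym (multiple i)) (sym (eq′ i))))

open TwoConfigurations

-- Clearing denominators in convex combinations.

module Denominators where
  open import Data.List using (map)
  open import Data.List.Properties using (length-map)
  open import Data.Rational as ℚ using (ℚ; 0ℚ; mkℚ; toℚᵘ)
  import Data.Rational.Properties as ℚ
  import Data.Rational.Unnormalised as ℚᵘ
  import Data.Rational.Unnormalised.Properties as ℚᵘ

  toℚᵘ-/ : ∀ i n → toℚᵘ (i ℚ./ suc n) ℚᵘ.≃ i ℚᵘ./ suc n
  toℚᵘ-/ i n = ℚ.toℚᵘ-fromℚᵘ (ℚᵘ.mkℚᵘ i n)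

  toℚ-+ : ∀ a b → toℚ (a ℤ.+ b) ≡ toℚ a ℚ.+ toℚ b
  toℚ-+ a b = ℚ.toℚᵘ-injective (begin
    toℚᵘ (toℚ (a ℤ.+ b))              ≈⟨ toℚᵘ-/ (a ℤ.+ b) 0 ⟩
    (a ℤ.+ b) ℚᵘ./ 1                  ≈⟨ ℚᵘ.*≡* (solve 2 (λ a b → (a :+ b) :* con (+ 1) := (a :* con (+ 1) :+ b :* con (+ 1)) :* con (+ 1)) refl a b) ⟩
    (a ℚᵘ./ 1) ℚᵘ.+ (b ℚᵘ./ 1)        ≈⟨ ℚᵘ.≃-sym (ℚᵘ.+-cong (toℚᵘ-/ a 0) (toℚᵘ-/ b 0)) ⟩
    toℚᵘ (toℚ a) ℚᵘ.+ toℚᵘ (toℚ b)    ≈⟨ ℚᵘ.≃-sym (ℚ.toℚᵘ-homo-+ (toℚ a) (toℚ b)) ⟩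
    toℚᵘ (toℚ a ℚ.+ toℚ b)            ∎)
    where
    open ℚᵘ.≃-Reasoning
    open ℤSolver.+-*-Solver

  toℚ-* : ∀ a b → toℚ (a ℤ.* b) ≡ toℚ a ℚ.* toℚ b
  toℚ-* a b = ℚ.toℚᵘ-injective (begin
    toℚᵘ (toℚ (a ℤ.* b))              ≈⟨ toℚᵘ-/ (a ℤ.* b) 0 ⟩
    (a ℤ.* b) ℚᵘ./ 1                  ≈⟨ ℚᵘ.*≡* refl ⟩
    (a ℚᵘ./ 1) ℚᵘ.* (b ℚᵘ./ 1)        ≈⟨ ℚᵘ.≃-sym (ℚᵘ.*-cong (toℚᵘ-/ a 0) (toℚᵘ-/ b 0)) ⟩
    toℚᵘ (toℚ a) ℚᵘ.* toℚᵘ (toℚ b)    ≈⟨ ℚᵘ.≃-sym (ℚ.toℚᵘ-homo-* (toℚ a) (toℚ b)) ⟩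
    toℚᵘ (toℚ a ℚ.* toℚ b)            ∎)
    where open ℚᵘ.≃-Reasoning

  toℚ-injective : ∀ {a b} → toℚ a ≡ toℚ b → a ≡ b
  toℚ-injective {a} {b} eq
    with ℚᵘ.*≡* p ← ℚᵘ.≃-trans (ℚᵘ.≃-sym (toℚᵘ-/ a 0)) (ℚᵘ.≃-trans (ℚᵘ.≃-reflexive (cong toℚᵘ eq)) (toℚᵘ-/ b 0)) =
    trans (sym (ℤ.*-identityʳ a)) (trans p (ℤ.*-identityʳ b))

  denominator-cancel : ∀ N i → toℚ (+ suc N) ℚ.* (i ℚ./ suc N) ≡ toℚ i
  denominator-cancel N i = ℚ.toℚᵘ-injective (begin
    toℚᵘ (toℚ (+ suc N) ℚ.* (i ℚ./ suc N))            ≈⟨ ℚ.toℚᵘ-homo-* (toℚ (+ suc N)) (i ℚ./ suc N) ⟩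
    toℚᵘ (toℚ (+ suc N)) ℚᵘ.* toℚᵘ (i ℚ./ suc N)      ≈⟨ ℚᵘ.*-cong (toℚᵘ-/ (+ suc N) 0) (toℚᵘ-/ i N) ⟩
    ((+ suc N) ℚᵘ./ 1) ℚᵘ.* (i ℚᵘ./ suc N)            ≈⟨ ℚᵘ.*≡* (trans (solve 2 (λ k i → (k :* i) :* con (+ 1) := i :* k) refl (+ suc N) i) (cong (λ x → i ℤ.* + suc x) (sym (ℕ.+-identityʳ N)))) ⟩
    i ℚᵘ./ 1                                          ≈⟨ ℚᵘ.≃-sym (toℚᵘ-/ i 0) ⟩
    toℚᵘ (toℚ i)                                      ∎)
    where
    open ℚᵘ.≃-Reasoning
    open ℤSolver.+-*-Solver

  cancel-positive : ∀ N {x y} → toℚ (+ suc N) ℚ.* x ≡ toℚ (+ suc N) ℚ.* y → x ≡ y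
  cancel-positive N eq = ℚ.≤-antisym (ℚ.*-cancelˡ-≤-pos (toℚ (+ suc N)) (ℚ.≤-reflexive eq))
                                     (ℚ.*-cancelˡ-≤-pos (toℚ (+ suc N)) (ℚ.≤-reflexive (sym eq)))
    where instance _ = ℚ.normalize-pos (suc N) 1

  ncomb : ∀ {d} → List ℕ → List (Vec ℤ d) → Fin d → ℤ
  ncomb (n ∷ ns) (v ∷ vs) i = + n ℤ.* lookup v i ℤ.+ ncomb ns vs i
  ncomb _        _        i = + 0

  data Scaled (M : ℕ) : List ℚ → List ℕ → Set where
    []  : Scaled M [] []
    _∷_ : ∀ {l n ls ns} → toℚ (+ M) ℚ.* l ≡ toℚ (+ n) → Scaled M ls ns → Scaled M (l ∷ ls) (n ∷ ns)

  qcomb-scaled : ∀ {d M ls ns} (V : List (Vec ℤ d)) → Scaled M ls ns →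
    ∀ i → toℚ (+ M) ℚ.* lookup (qcomb ls V) i ≡ toℚ (ncomb ns V i)
  qcomb-scaled {M = M} []      []       i = trans (cong (toℚ (+ M) ℚ.*_) (lookup-replicate i 0ℚ)) (ℚ.*-zeroʳ (toℚ (+ M)))
  qcomb-scaled {M = M} (v ∷ V) []       i = trans (cong (toℚ (+ M) ℚ.*_) (lookup-replicate i 0ℚ)) (ℚ.*-zeroʳ (toℚ (+ M)))
  qcomb-scaled {M = M} []      (_ ∷ _)  i = trans (cong (toℚ (+ M) ℚ.*_) (lookup-replicate i 0ℚ)) (ℚ.*-zeroʳ (toℚ (+ M)))
  qcomb-scaled {M = M} {l ∷ ls} {n ∷ ns} (v ∷ V) (eq ∷ eqs) i = begin
    m ℚ.* lookup (qcomb (l ∷ ls) (v ∷ V)) i                     ≡⟨ cong (m ℚ.*_) (lookup-zipWith ℚ._+_ i (Vec.map (λ z → l ℚ.* toℚ z) v) (qcomb ls V)) ⟩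
    m ℚ.* (lookup (Vec.map (λ z → l ℚ.* toℚ z) v) i ℚ.+ r)      ≡⟨ cong (λ x → m ℚ.* (x ℚ.+ r)) (lookup-map i _ v) ⟩
    m ℚ.* (l ℚ.* toℚ (lookup v i) ℚ.+ r)                        ≡⟨ ℚ.*-distribˡ-+ m _ r ⟩
    m ℚ.* (l ℚ.* toℚ (lookup v i)) ℚ.+ m ℚ.* r                  ≡⟨ cong₂ ℚ._+_ (sym (ℚ.*-assoc m l _)) (qcomb-scaled V eqs i) ⟩
    m ℚ.* l ℚ.* toℚ (lookup v i) ℚ.+ toℚ (ncomb ns V i)         ≡⟨ cong (λ x → x ℚ.* toℚ (lookup v i) ℚ.+ toℚ (ncomb ns V i)) eq ⟩
    toℚ (+ n) ℚ.* toℚ (lookup v i) ℚ.+ toℚ (ncomb ns V i)       ≡⟨ cong (ℚ._+ toℚ (ncomb ns V i)) (sym (toℚ-* (+ n) (lookup v i))) ⟩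
    toℚ (+ n ℤ.* lookup v i) ℚ.+ toℚ (ncomb ns V i)             ≡⟨ sym (toℚ-+ (+ n ℤ.* lookup v i) (ncomb ns V i)) ⟩
    toℚ (+ n ℤ.* lookup v i ℤ.+ ncomb ns V i)                   ∎
    where
    open ≡-Reasoning
    m = toℚ (+ M)
    r = lookup (qcomb ls V) i

  sum-scaled : ∀ {M ls ns} → Scaled M ls ns → toℚ (+ M) ℚ.* List.foldr ℚ._+_ 0ℚ ls ≡ toℚ (+ sum ns)
  sum-scaled {M} []                              = ℚ.*-zeroʳ (toℚ (+ M))
  sum-scaled {M} {l ∷ ls} {n ∷ ns} (eq ∷ eqs) = trans (ℚ.*-distribˡ-+ (toℚ (+ M)) l _)
    (trans (cong₂ ℚ._+_ eq (sum-scaled eqs)) (sym (toℚ-+ (+ n) (+ sum ns))))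

  length-scaled : ∀ {M ls ns} → Scaled M ls ns → length ls ≡ length ns
  length-scaled []       = refl
  length-scaled (_ ∷ sc) = cong suc (length-scaled sc)

  rescale : ∀ {M ls ns} k → Scaled M ls ns → Scaled (k ℕ.* M) ls (map (k ℕ.*_) ns)
  rescale k [] = []
  rescale {M} {l ∷ _} {n ∷ _} k (eq ∷ eqs) = trans (cong (λ x → x ℚ.* l) (trans (cong toℚ (ℤ.pos-* k M)) (toℚ-* (+ k) (+ M))))
    (trans (ℚ.*-assoc (toℚ (+ k)) _ l) (trans (cong (toℚ (+ k) ℚ.*_) eq) (trans (sym (toℚ-* (+ k) (+ n))) (cong toℚ (sym (ℤ.pos-* k n))))))
    ∷ rescale k eqs

  clear-denominators : ∀ {ls} → All (0ℚ ℚ.≤_) ls → ∃ λ N → ∃ λ ns → Scaled (suc N) ls ns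
  clear-denominators [] = 0 , [] , []
  clear-denominators {l@(mkℚ (+ p) q c) ∷ ls} (0≤l ∷ 0≤ls) with N , ns , sc ← clear-denominators 0≤ls =
    -- The new denominator is `suc q * suc N`, given by its predecessor. The head `p / (q + 1)`
    -- becomes `(N + 1) p`, and the earlier numerators are multiplied by `q + 1`.
    N ℕ.+ q ℕ.* suc N , suc N ℕ.* p ∷ map (suc q ℕ.*_) ns , head ∷ rescale (suc q) sc
    where
    open ≡-Reasoning
    head : toℚ (+ (suc q ℕ.* suc N)) ℚ.* l ≡ toℚ (+ (suc N ℕ.* p))
    head = begin
      toℚ (+ (suc q ℕ.* suc N)) ℚ.* l                     ≡⟨ cong (λ x → toℚ (+ x) ℚ.* l) (ℕ.*-comm (suc q) (suc N)) ⟩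
      toℚ (+ (suc N ℕ.* suc q)) ℚ.* l                     ≡⟨ cong (λ x → toℚ x ℚ.* l) (ℤ.pos-* (suc N) (suc q)) ⟩
      toℚ (+ suc N ℤ.* + suc q) ℚ.* l                     ≡⟨ cong (ℚ._* l) (toℚ-* (+ suc N) (+ suc q)) ⟩
      toℚ (+ suc N) ℚ.* toℚ (+ suc q) ℚ.* l               ≡⟨ ℚ.*-assoc (toℚ (+ suc N)) _ l ⟩
      toℚ (+ suc N) ℚ.* (toℚ (+ suc q) ℚ.* l)             ≡⟨ cong (λ x → toℚ (+ suc N) ℚ.* (toℚ (+ suc q) ℚ.* x)) (sym (ℚ.↥p/↧p≡p l)) ⟩
      toℚ (+ suc N) ℚ.* (toℚ (+ suc q) ℚ.* (+ p ℚ./ suc q)) ≡⟨ cong (toℚ (+ suc N) ℚ.*_) (denominator-cancel q (+ p)) ⟩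
      toℚ (+ suc N) ℚ.* toℚ (+ p)                         ≡⟨ sym (toℚ-* (+ suc N) (+ p)) ⟩
      toℚ (+ suc N ℤ.* + p)                               ≡⟨ cong toℚ (sym (ℤ.pos-* (suc N) p)) ⟩
      toℚ (+ (suc N ℕ.* p))                               ∎
  clear-denominators {mkℚ -[1+ p ] q c ∷ ls} (0≤l ∷ _) with () ← ℤ.NonNegative.nonNeg (ℚ.nonNegative 0≤l)

  -- The rational weights multiplied by a common denominator; this is the source of the multiples
  -- `(N + 1) z`. The successor keeps the multiplier positive, so it can be cancelled again.
  IntDil : ∀ {d} → ℕ → List (Vec ℤ d) → Vec ℤ d → Set
  IntDil k V z = ∃ λ N → ∃ λ ns → length ns ≡ length V × sum ns ≡ suc N ℕ.* k ×
    (∀ i → ncomb ns V i ≡ + suc N ℤ.* lookup z i)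

  InDil⇒IntDil : ∀ {d k} {V : List (Vec ℤ d)} {z} → InDil k V z → IntDil k V z
  InDil⇒IntDil {k = k} {V} {z} (ls , len , 0≤ls , total , comb) with N , ns , sc ← clear-denominators 0≤ls =
    N , ns , trans (sym (length-scaled sc)) len ,
    ℤ.+-injective (toℚ-injective (trans (sym (sum-scaled sc)) (trans (cong (toℚ (+ suc N) ℚ.*_) total)
      (trans (sym (toℚ-* (+ suc N) (+ k))) (cong toℚ (sym (ℤ.pos-* (suc N) k))))))) ,
    λ i → toℚ-injective (trans (sym (qcomb-scaled V sc i)) (trans (cong (toℚ (+ suc N) ℚ.*_)
      (trans (cong (λ w → lookup w i) comb) (lookup-map i toℚ z))) (sym (toℚ-* (+ suc N) (lookup z i)))))

  IntDil⇒InDil : ∀ {d k} {V : List (Vec ℤ d)} {z} → IntDil k V z → InDil k V z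
  IntDil⇒InDil {k = k} {V} {z} (N , ns , len , total , comb) =
    ls , trans (length-map _ ns) len , nonneg ns ,
    cancel-positive N (trans (sum-scaled sc) (trans (cong toℚ (trans (cong +_ total) (ℤ.pos-* (suc N) k))) (toℚ-* (+ suc N) (+ k)))) ,
    lookup-ext λ i → cancel-positive N (trans (qcomb-scaled V sc i) (trans (cong toℚ (comb i))
      (trans (toℚ-* (+ suc N) (lookup z i)) (cong (toℚ (+ suc N) ℚ.*_) (sym (lookup-map i toℚ z))))))
    where
    divide : ℕ → ℚ
    divide n = + n ℚ./ suc N
    ls = map divide ns
    nonneg : ∀ ns → All (0ℚ ℚ.≤_) (map divide ns)
    nonneg [] = []
    nonneg (n ∷ ns) = ℚ.nonNegative⁻¹ (divide n) {{ℚ.normalize-nonNeg n (suc N)}} ∷ nonneg ns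
    scaled : ∀ ns → Scaled (suc N) (map divide ns) ns
    scaled [] = []
    scaled (n ∷ ns) = denominator-cancel N (+ n) ∷ scaled ns
    sc = scaled ns

open Denominators

-- Dilates of Γ and Ω in terms of pairs of monomials, and lattice generation.

module LatticePoints where
  open import Data.Fin using (inject₁)
  open import Data.List using (map; _++_)
  open import Data.List.Properties using (length-map; length-++)
  open import Data.List.Membership.Propositional.Properties using (∈-++⁻; ∈-map⁻)
  open import Data.Nat.ListAction.Properties using (sum-++)

  lookup-∷ʳ-inject₁ : ∀ {a} {X : Set a} {n} (xs : Vec X n) x i → lookup (xs ∷ʳ x) (inject₁ i) ≡ lookup xs i
  lookup-∷ʳ-inject₁ (y ∷ xs) x zero    = refl
  lookup-∷ʳ-inject₁ (y ∷ xs) x (suc i) = lookup-∷ʳ-inject₁ xs x i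

  lookup-∷ʳ-last : ∀ {a} {X : Set a} {n} (xs : Vec X n) x → lookup (xs ∷ʳ x) (fromℕ n) ≡ x
  lookup-∷ʳ-last []       x = refl
  lookup-∷ʳ-last (y ∷ xs) x = lookup-∷ʳ-last xs x

  ∷ʳ-pointwise : ∀ {n} {P : Fin (suc n) → Set} → (∀ i → P (inject₁ i)) → P (fromℕ n) → ∀ i → P i
  ∷ʳ-pointwise {zero}  ps p zero    = p
  ∷ʳ-pointwise {suc n} ps p zero    = ps zero
  ∷ʳ-pointwise {suc n} {P} ps p (suc i) = ∷ʳ-pointwise {n} {λ i → P (suc i)} (λ i → ps (suc i)) p i

  fromLength : ∀ m (ns : List ℕ) → length ns ≡ m → ∃ λ (v : Mon m) → ns ≡ toList v
  fromLength zero    []       refl = [] , refl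
  fromLength (suc m) (n ∷ ns) eq with v , refl ← fromLength m ns (ℕ.suc-injective eq) = n ∷ v , refl

  fromLength₂ : ∀ n m (ns : List ℕ) → length ns ≡ n ℕ.+ m →
    ∃ λ (u : Mon n) → ∃ λ (v : Mon m) → ns ≡ toList u ++ toList v
  fromLength₂ zero    m ns       eq = [] , fromLength m ns eq
  fromLength₂ (suc n) m (k ∷ ns) eq with u , v , refl ← fromLength₂ n m ns (ℕ.suc-injective eq) = k ∷ u , v , refl

  sum-toList : ∀ {n} (u : Mon n) → sum (toList u) ≡ deg u
  sum-toList []      = refl
  sum-toList (x ∷ u) = cong (x ℕ.+_) (sum-toList u)

  ncomb-++ : ∀ {d} ns (V : List (Vec ℤ d)) ms W i → length ns ≡ length V →
    ncomb (ns ++ ms) (V ++ W) i ≡ ncomb ns V i ℤ.+ ncomb ms W i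
  ncomb-++ []       []      ms W i _  = sym (ℤ.+-identityˡ _)
  ncomb-++ (n ∷ ns) (v ∷ V) ms W i eq =
    trans (cong (λ x → + n ℤ.* lookup v i ℤ.+ x) (ncomb-++ ns V ms W i (ℕ.suc-injective eq)))
          (sym (ℤ.+-assoc (+ n ℤ.* lookup v i) _ _))

  -- The sign `c` is `1` for the columns of `A` and `-1` for those of `B`. The target coordinate `j`
  -- is kept apart from the coordinate `i` of the columns because Ω appends a height.
  module _ {d d′} (f : Vec ℕ d → Vec ℤ d′) (c : ℤ) (j : Fin d′) where
    open ≡-Reasoning
    open ℤSolver.+-*-Solver

    ncomb-matVec : ∀ i → (∀ a → lookup (f a) j ≡ c ℤ.* + lookup a i) →
      ∀ {n} (A : Vec (Vec ℕ d) n) (u : Mon n) → ncomb (toList u) (map f (toList A)) j ≡ c ℤ.* + lookup (matVec A u) i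
    ncomb-matVec i h []      []      = sym (trans (cong (λ x → c ℤ.* + x) (lookup-𝟘 i)) (ℤ.*-zeroʳ c))
    ncomb-matVec i h (a ∷ A) (k ∷ u) = begin
      + k ℤ.* lookup (f a) j ℤ.+ ncomb (toList u) (map f (toList A)) j       ≡⟨ cong₂ (λ x y → + k ℤ.* x ℤ.+ y) (h a) (ncomb-matVec i h A u) ⟩
      + k ℤ.* (c ℤ.* + lookup a i) ℤ.+ c ℤ.* + lookup (matVec A u) i         ≡⟨ arith (+ k) c (+ lookup a i) (+ lookup (matVec A u) i) ⟩
      c ℤ.* (+ k ℤ.* + lookup a i ℤ.+ + lookup (matVec A u) i)               ≡⟨ cong (λ x → c ℤ.* (x ℤ.+ + lookup (matVec A u) i)) (sym (ℤ.pos-* k (lookup a i))) ⟩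
      c ℤ.* + (k ℕ.* lookup a i ℕ.+ lookup (matVec A u) i)                   ≡⟨ cong (λ x → c ℤ.* + (x ℕ.+ lookup (matVec A u) i)) (sym (lookup-⊛ᵐ k a i)) ⟩
      c ℤ.* + (lookup (k ⊛ a) i ℕ.+ lookup (matVec A u) i)                   ≡⟨ cong (λ x → c ℤ.* + x) (sym (lookup-⊕ (k ⊛ a) (matVec A u) i)) ⟩
      c ℤ.* + lookup (matVec (a ∷ A) (k ∷ u)) i                              ∎
      where
      arith : ∀ k c a m → k ℤ.* (c ℤ.* a) ℤ.+ c ℤ.* m ≡ c ℤ.* (k ℤ.* a ℤ.+ m)
      arith = solve 4 (λ k c a m → k :* (c :* a) :+ c :* m := c :* (k :* a :+ m)) refl

    ncomb-deg : (∀ a → lookup (f a) j ≡ c) →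
      ∀ {n} (A : Vec (Vec ℕ d) n) (u : Mon n) → ncomb (toList u) (map f (toList A)) j ≡ c ℤ.* + deg u
    ncomb-deg h []      []      = sym (ℤ.*-zeroʳ c)
    ncomb-deg h (a ∷ A) (k ∷ u) = begin
      + k ℤ.* lookup (f a) j ℤ.+ ncomb (toList u) (map f (toList A)) j  ≡⟨ cong₂ (λ x y → + k ℤ.* x ℤ.+ y) (h a) (ncomb-deg h A u) ⟩
      + k ℤ.* c ℤ.+ c ℤ.* + deg u                                       ≡⟨ solve 3 (λ k c m → k :* c :+ c :* m := c :* (k :+ m)) refl (+ k) c (+ deg u) ⟩
      c ℤ.* + (k ℕ.+ deg u)                                             ∎

  module Points {d n m} (A : Vec (Vec ℕ d) n) (B : Vec (Vec ℕ d) m) where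
    open Signed A B

    posneg : ∀ a b → ℤ.1ℤ ℤ.* a ℤ.+ ℤ.-1ℤ ℤ.* b ≡ a ℤ.- b
    posneg a b = cong₂ ℤ._+_ (ℤ.*-identityˡ a) (ℤ.-1*i≡-i b)

    ncomb-signed : ∀ {d′} (f g : Vec ℕ d → Vec ℤ d′) i j → (∀ a → lookup (f a) j ≡ + lookup a i) →
      (∀ b → lookup (g b) j ≡ ℤ.- + lookup b i) → ∀ u v →
      ncomb (toList u ++ toList v) (map f (toList A) ++ map g (toList B)) j ≡ ⟦ u , v ⟧ i
    ncomb-signed f g i j hf hg u v =
      trans (ncomb-++ (toList u) (map f (toList A)) (toList v) (map g (toList B)) j (trans (length-toList u) (sym (trans (length-map f (toList A)) (length-toList A)))))
      (trans (cong₂ ℤ._+_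
        (ncomb-matVec f ℤ.1ℤ j i (λ a → trans (hf a) (sym (ℤ.*-identityˡ _))) A u)
        (ncomb-matVec g ℤ.-1ℤ j i (λ b → trans (hg b) (sym (ℤ.-1*i≡-i _))) B v))
      (posneg (+ lookup (matVec A u) i) (+ lookup (matVec B v) i)))

    ncomb-height : ∀ {d′} (f g : Vec ℕ d → Vec ℤ d′) j → (∀ a → lookup (f a) j ≡ ℤ.1ℤ) →
      (∀ b → lookup (g b) j ≡ ℤ.-1ℤ) → ∀ (u : Mon n) (v : Mon m) →
      ncomb (toList u ++ toList v) (map f (toList A) ++ map g (toList B)) j ≡ + deg u ℤ.- + deg v
    ncomb-height f g j hf hg u v =
      trans (ncomb-++ (toList u) (map f (toList A)) (toList v) (map g (toList B)) j (trans (length-toList u) (sym (trans (length-map f (toList A)) (length-toList A)))))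
      (trans (cong₂ ℤ._+_ (ncomb-deg f ℤ.1ℤ j hf A u) (ncomb-deg g ℤ.-1ℤ j hg B v)) (posneg (+ deg u) (+ deg v)))

    length-columns : ∀ {d′} (f g : Vec ℕ d → Vec ℤ d′) → length (map f (toList A) ++ map g (toList B)) ≡ n ℕ.+ m
    length-columns f g = trans (length-++ (map f (toList A))) (cong₂ ℕ._+_
      (trans (length-map f (toList A)) (length-toList A)) (trans (length-map g (toList B)) (length-toList B)))

    sum-columns : ∀ (u : Mon n) (v : Mon m) → sum (toList u ++ toList v) ≡ deg u ℕ.+ deg v
    sum-columns u v = trans (sum-++ (toList u) (toList v)) (cong₂ ℕ._+_ (sum-toList u) (sum-toList v))

    length-exponents : ∀ (u : Mon n) (v : Mon m) → length (toList u ++ toList v) ≡ n ℕ.+ m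
    length-exponents u v = trans (length-++ (toList u)) (cong₂ ℕ._+_ (length-toList u) (length-toList v))

    Γ-Multiple : ℕ → Vec ℤ d → Set
    Γ-Multiple k z = ∃ λ N → ∃ λ u → ∃ λ v → deg u ℕ.+ deg v ≡ suc N ℕ.* k ×
      (∀ i → ⟦ u , v ⟧ i ≡ + suc N ℤ.* lookup z i)

    Ω-Multiple : ℕ → Vec ℤ d → ℤ → Set
    Ω-Multiple k z t = ∃ λ N → ∃ λ u → ∃ λ v → deg u ℕ.+ deg v ≡ suc N ℕ.* k ×
      (∀ i → ⟦ u , v ⟧ i ≡ + suc N ℤ.* lookup z i) × + deg u ℤ.- + deg v ≡ + suc N ℤ.* t

    private
      γ⁺ : Vec ℕ d → Vec ℤ d
      γ⁺ = posℤ
      γ⁻ : Vec ℕ d → Vec ℤ d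
      γ⁻ = negℤ
      ω⁺ : Vec ℕ d → Vec ℤ (suc d)
      ω⁺ a = posℤ a ∷ʳ + 1
      ω⁻ : Vec ℕ d → Vec ℤ (suc d)
      ω⁻ b = negℤ b ∷ʳ ℤ.- (+ 1)

      ncomb-γ : ∀ u v i → ncomb (toList u ++ toList v) (ΓV A B) i ≡ ⟦ u , v ⟧ i
      ncomb-γ u v i = ncomb-signed γ⁺ γ⁻ i i (λ a → lookup-map i +_ a) (λ b → lookup-map i (λ x → ℤ.- (+ x)) b) u v

      ncomb-ω : ∀ u v i → ncomb (toList u ++ toList v) (ΩV A B) (inject₁ i) ≡ ⟦ u , v ⟧ i
      ncomb-ω u v i = ncomb-signed ω⁺ ω⁻ i (inject₁ i)
        (λ a → trans (lookup-∷ʳ-inject₁ (posℤ a) _ i) (lookup-map i +_ a))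
        (λ b → trans (lookup-∷ʳ-inject₁ (negℤ b) _ i) (lookup-map i (λ x → ℤ.- (+ x)) b)) u v

      ncomb-ω-last : ∀ u v → ncomb (toList u ++ toList v) (ΩV A B) (fromℕ d) ≡ + deg u ℤ.- + deg v
      ncomb-ω-last u v = ncomb-height ω⁺ ω⁻ (fromℕ d)
        (λ a → lookup-∷ʳ-last (posℤ a) _) (λ b → lookup-∷ʳ-last (negℤ b) _) u v

    Γ-multiple⁺ : ∀ {k z} → InDil k (ΓV A B) z → Γ-Multiple k z
    Γ-multiple⁺ {k} {z} dil with N , ns , len , total , comb ← InDil⇒IntDil {k = k} {ΓV A B} {z} dil
      with u , v , refl ← fromLength₂ n m ns (trans len (length-columns γ⁺ γ⁻)) =
      N , u , v , trans (sym (sum-columns u v)) total , λ i → trans (sym (ncomb-γ u v i)) (comb i)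

    Γ-multiple⁻ : ∀ {k z} → Γ-Multiple k z → InDil k (ΓV A B) z
    Γ-multiple⁻ {k} {z} (N , u , v , total , comb) = IntDil⇒InDil {k = k} {ΓV A B} {z}
      (N , toList u ++ toList v , trans (length-exponents u v) (sym (length-columns γ⁺ γ⁻)) ,
       trans (sum-columns u v) total , λ i → trans (ncomb-γ u v i) (comb i))

    Ω-multiple⁺ : ∀ {k z t} → InDil k (ΩV A B) (z ∷ʳ t) → Ω-Multiple k z t
    Ω-multiple⁺ {k} {z} {t} dil with N , ns , len , total , comb ← InDil⇒IntDil {k = k} {ΩV A B} {z ∷ʳ t} dil
      with u , v , refl ← fromLength₂ n m ns (trans len (length-columns ω⁺ ω⁻)) =
      N , u , v , trans (sym (sum-columns u v)) total ,
      (λ i → trans (sym (ncomb-ω u v i)) (trans (comb (inject₁ i)) (cong (+ suc N ℤ.*_) (lookup-∷ʳ-inject₁ z t i)))) ,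
      trans (sym (ncomb-ω-last u v)) (trans (comb (fromℕ d)) (cong (+ suc N ℤ.*_) (lookup-∷ʳ-last z t)))

    Ω-multiple⁻ : ∀ {k z t} → Ω-Multiple k z t → InDil k (ΩV A B) (z ∷ʳ t)
    Ω-multiple⁻ {k} {z} {t} (N , u , v , total , comb , height) = IntDil⇒InDil {k = k} {ΩV A B} {z ∷ʳ t}
      (N , toList u ++ toList v , trans (length-exponents u v) (sym (length-columns ω⁺ ω⁻)) ,
       trans (sum-columns u v) total ,
       ∷ʳ-pointwise
         (λ i → trans (ncomb-ω u v i) (trans (comb i) (cong (+ suc N ℤ.*_) (sym (lookup-∷ʳ-inject₁ z t i)))))
         (trans (ncomb-ω-last u v) (trans height (cong (+ suc N ℤ.*_) (sym (lookup-∷ʳ-last z t))))))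

  ∈-init⁻ : ∀ {a} {X : Set a} {n} {x : X} (xs : Vec X (suc n)) → x ∈ toList (init xs) → ∃ λ j → lookup xs j ≡ x
  ∈-init⁻ {n = suc n} (y ∷ z ∷ xs) (here refl) = zero , refl
  ∈-init⁻ {n = suc n} (y ∷ z ∷ xs) (there x∈)  = let j , eq = ∈-init⁻ (z ∷ xs) x∈ in suc j , eq

  module Lattice {d n m} (A : Vec (Vec ℕ d) (suc n)) (B : Vec (Vec ℕ d) (suc m))
    (generated : LatticeGen (ΓV A B)) (points : ΓPointsHyp A B) where
    open Signed A B

    -- Exponents cannot be negative, so a value of an integer combination is kept as a difference of
    -- two images; points with negative coefficient are added to the subtracted one.
    Represented : (Fin d → ℤ) → Set
    Represented z = ∃ λ s → ∃ λ t → ∃ λ s′ → ∃ λ t′ → ∀ i → ⟦ s , t ⟧ i ≡ z i ℤ.+ ⟦ s′ , t′ ⟧ i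

    ⟦𝟘⟧ʳ : ∀ u i → ⟦ u , 𝟘 ⟧ i ≡ + lookup (matVec A u) i
    ⟦𝟘⟧ʳ u i = trans (cong (λ w → + lookup (matVec A u) i ℤ.- + lookup w i) (matVec-𝟘 B))
      (trans (cong (λ x → + lookup (matVec A u) i ℤ.- + x) (lookup-𝟘 i)) (ℤ.+-identityʳ _))

    ⟦𝟘⟧ˡ : ∀ v i → ⟦ 𝟘 , v ⟧ i ≡ ℤ.- + lookup (matVec B v) i
    ⟦𝟘⟧ˡ v i = trans (cong (λ w → + lookup w i ℤ.- + lookup (matVec B v) i) (matVec-𝟘 A))
      (trans (cong (λ x → + x ℤ.- + lookup (matVec B v) i) (lookup-𝟘 i)) (ℤ.+-identityˡ _))

    -- By hypothesis a lattice point of Γ is a column of `A`, a negated column of `B` or the origin,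
    -- and these are images of unit monomials or of the trivial pair.
    point : ∀ p → InDil 1 (ΓV A B) p → ∃ λ u → ∃ λ v → ∀ i → ⟦ u , v ⟧ i ≡ lookup p i
    point p dil with ∈-++⁻ (map posℤ (toList (init A))) (proj₁ (points p) dil)
    ... | inj₁ p∈A with a , a∈A , refl ← ∈-map⁻ posℤ p∈A with j , refl ← ∈-init⁻ A a∈A =
      unit j , 𝟘 , λ i → trans (⟦𝟘⟧ʳ (unit j) i) (trans (cong (λ w → + lookup w i) (matVec-unit A j)) (sym (lookup-map i +_ (lookup A j))))
    ... | inj₂ p∈ with ∈-++⁻ (map negℤ (toList (init B))) p∈
    ...   | inj₁ p∈B with b , b∈B , refl ← ∈-map⁻ negℤ p∈B with j , refl ← ∈-init⁻ B b∈B =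
      𝟘 , unit j , λ i → trans (⟦𝟘⟧ˡ (unit j) i) (trans (cong (λ w → ℤ.- + lookup w i) (matVec-unit B j)) (sym (lookup-map i (λ x → ℤ.- (+ x)) (lookup B j))))
    ...   | inj₂ (here refl) = 𝟘 , 𝟘 , λ i → trans (⟦𝟘⟧ʳ 𝟘 i)
      (trans (cong (λ w → + lookup w i) (matVec-𝟘 A)) (trans (cong +_ (lookup-𝟘 i)) (sym (lookup-replicate i (+ 0)))))

    combination : ∀ (cs : List (ℤ × Vec ℤ d)) → All (λ cp → InDil 1 (ΓV A B) (proj₂ cp)) cs →
      Represented (λ i → lookup (zcomb (map (λ cp → proj₁ cp , (proj₂ cp ∷ʳ + 1)) cs)) (inject₁ i))
    combination [] [] = 𝟘 , 𝟘 , 𝟘 , 𝟘 , λ i →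
      sym (trans (cong (ℤ._+ ⟦ 𝟘 , 𝟘 ⟧ i) (lookup-replicate (inject₁ i) (+ 0))) (ℤ.+-identityˡ _))
    combination ((c , p) ∷ cs) (dil ∷ dils) = extend c (point p dil) (combination cs dils)
      where
      rest = zcomb (map (λ cp → proj₁ cp , (proj₂ cp ∷ʳ + 1)) cs)
      extend : ∀ c → (∃ λ u → ∃ λ v → ∀ i → ⟦ u , v ⟧ i ≡ lookup p i) →
        Represented (λ i → lookup rest (inject₁ i)) →
        Represented (λ i → lookup (Vec.zipWith ℤ._+_ (Vec.map (c ℤ.*_) (p ∷ʳ + 1)) rest) (inject₁ i))
      extend c (u , v , uv≡p) (s , t , s′ , t′ , eq) = by-sign c refl
        where
        head : ∀ i → lookup (Vec.zipWith ℤ._+_ (Vec.map (c ℤ.*_) (p ∷ʳ + 1)) rest) (inject₁ i) ≡ c ℤ.* ⟦ u , v ⟧ i ℤ.+ lookup rest (inject₁ i)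
        head i = trans (lookup-zipWith ℤ._+_ (inject₁ i) (Vec.map (c ℤ.*_) (p ∷ʳ + 1)) rest)
          (cong (ℤ._+ lookup rest (inject₁ i)) (trans (lookup-map (inject₁ i) (c ℤ.*_) (p ∷ʳ + 1))
            (cong (c ℤ.*_) (trans (lookup-∷ʳ-inject₁ p (+ 1) i) (sym (uv≡p i))))))
        add : ∀ k x y i → ⟦ (k ⊛ u) ⊕ x , (k ⊛ v) ⊕ y ⟧ i ≡ + k ℤ.* ⟦ u , v ⟧ i ℤ.+ ⟦ x , y ⟧ i
        add k x y i = trans (⟦⟧-⊕ (k ⊛ u) (k ⊛ v) x y i) (cong (ℤ._+ ⟦ x , y ⟧ i) (⟦⟧-⊛ k u v i))
        open ≡-Reasoning
        open ℤSolver.+-*-Solver using (solve; _:+_; _:*_; :-_; _:=_)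
        by-sign : ∀ c′ → c′ ≡ c → Represented (λ i → lookup (Vec.zipWith ℤ._+_ (Vec.map (c ℤ.*_) (p ∷ʳ + 1)) rest) (inject₁ i))
        by-sign (+ k) refl = (k ⊛ u) ⊕ s , (k ⊛ v) ⊕ t , s′ , t′ , λ i → begin
          ⟦ (k ⊛ u) ⊕ s , (k ⊛ v) ⊕ t ⟧ i                                      ≡⟨ add k s t i ⟩
          + k ℤ.* ⟦ u , v ⟧ i ℤ.+ ⟦ s , t ⟧ i                                  ≡⟨ cong (λ x → + k ℤ.* ⟦ u , v ⟧ i ℤ.+ x) (eq i) ⟩
          + k ℤ.* ⟦ u , v ⟧ i ℤ.+ (lookup rest (inject₁ i) ℤ.+ ⟦ s′ , t′ ⟧ i)  ≡⟨ sym (ℤ.+-assoc (+ k ℤ.* ⟦ u , v ⟧ i) _ _) ⟩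
          + k ℤ.* ⟦ u , v ⟧ i ℤ.+ lookup rest (inject₁ i) ℤ.+ ⟦ s′ , t′ ⟧ i    ≡⟨ cong (ℤ._+ ⟦ s′ , t′ ⟧ i) (sym (head i)) ⟩
          _                                                                    ∎
        by-sign (-[1+ k ]) refl = s , t , (suc k ⊛ u) ⊕ s′ , (suc k ⊛ v) ⊕ t′ , λ i → begin
          ⟦ s , t ⟧ i                                                          ≡⟨ eq i ⟩
          lookup rest (inject₁ i) ℤ.+ ⟦ s′ , t′ ⟧ i                            ≡⟨ arith (+ suc k) ⟦ u , v ⟧ (λ i → lookup rest (inject₁ i)) ⟦ s′ , t′ ⟧ i ⟩
          (c ℤ.* ⟦ u , v ⟧ i ℤ.+ lookup rest (inject₁ i)) ℤ.+ (+ suc k ℤ.* ⟦ u , v ⟧ i ℤ.+ ⟦ s′ , t′ ⟧ i)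
            ≡⟨ sym (cong₂ ℤ._+_ (head i) (add (suc k) s′ t′ i)) ⟩
          _                                                                    ∎
          where
          arith : ∀ k (x r y : Fin d → ℤ) i → r i ℤ.+ y i ≡ ((ℤ.- k) ℤ.* x i ℤ.+ r i) ℤ.+ (k ℤ.* x i ℤ.+ y i)
          arith k x r y i = solve 4 (λ k x r y → r :+ y := (:- k :* x :+ r) :+ (k :* x :+ y)) refl k (x i) (r i) (y i)

    lattice : ∀ z → Represented (lookup z)
    -- The appended height `0` is an arbitrary choice: only the first `d` coordinates of the
    -- combination are read.
    lattice z with cs , dils , eq ← generated (z ∷ʳ + 0) with s , t , s′ , t′ , rep ← combination cs dils =
      s , t , s′ , t′ , λ i → trans (rep i) (cong (ℤ._+ ⟦ s′ , t′ ⟧ i)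
        (trans (cong (λ w → lookup w (inject₁ i)) (sym eq)) (lookup-∷ʳ-inject₁ z (+ 0) i)))

open LatticePoints

-- From the recurrence of counts to the identity of δ-series.

module DeltaVectors where
  open import Data.Integer using (_+_; _*_; _-_; -_)
  open ℤSolver.+-*-Solver using (solve; _:+_; _:*_; _:-_; :-_; _:=_; con)
  open import Data.List using (map; foldr; upTo; applyUpTo)
  open import Data.Nat.Combinatorics using (_C_; nCk+nC[k+1]≡[n+1]C[k+1])
  import Data.Sign.Base as Sign

  partialSum : (ℕ → ℤ) → ℕ → ℤ
  partialSum f zero    = + 0
  partialSum f (suc n) = f 0 + partialSum (f ∘ suc) n

  sum-map : ∀ (f : ℕ → ℤ) (g : ℕ → ℕ) n → foldr _+_ (+ 0) (map f (applyUpTo g n)) ≡ partialSum (f ∘ g) n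
  sum-map f g zero    = refl
  sum-map f g (suc n) = cong (λ x → f (g 0) + x) (sum-map f (g ∘ suc) n)

  sum-upTo : ∀ f n → foldr _+_ (+ 0) (map f (upTo n)) ≡ partialSum f n
  sum-upTo f n = sum-map f id n

  partialSum-last : ∀ f n → partialSum f (suc n) ≡ partialSum f n + f n
  partialSum-last f zero    = ℤ.+-comm (f 0) (+ 0)
  partialSum-last f (suc n) = trans (cong (λ x → f 0 + x) (partialSum-last (f ∘ suc) n)) (sym (ℤ.+-assoc (f 0) _ _))

  partialSum-cong : ∀ {f g} n → (∀ j → f j ≡ g j) → partialSum f n ≡ partialSum g n
  partialSum-cong zero    eq = refl
  partialSum-cong (suc n) eq = cong₂ _+_ (eq 0) (partialSum-cong n (eq ∘ suc))

  -- The coefficient of `λ^k` in the product of two power series. The recursion shifts `c` and keeps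
  -- `L`, so hypotheses on `L` reach the recursive call unchanged.
  convolve : (ℕ → ℤ) → (ℕ → ℤ) → ℕ → ℤ
  convolve c L zero    = c 0 * L 0
  convolve c L (suc k) = c 0 * L (suc k) + convolve (c ∘ suc) L k

  convolve-partialSum : ∀ c L k → partialSum (λ j → c j * L (k ∸ j)) (suc k) ≡ convolve c L k
  convolve-partialSum c L zero    = ℤ.+-identityʳ _
  convolve-partialSum c L (suc k) = cong (λ x → c 0 * L (suc k) + x) (convolve-partialSum (c ∘ suc) L k)

  convolve-cong : ∀ {c c′} L k → (∀ j → c j ≡ c′ j) → convolve c L k ≡ convolve c′ L k
  convolve-cong L zero    eq = cong (_* L 0) (eq 0)
  convolve-cong L (suc k) eq = cong₂ _+_ (cong (_* L (suc k)) (eq 0)) (convolve-cong L k (eq ∘ suc))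

  convolve-minus : ∀ c c′ L k → convolve (λ j → c j - c′ j) L k ≡ convolve c L k - convolve c′ L k
  convolve-minus c c′ L zero    = solve 3 (λ a b l → (a :- b) :* l := a :* l :- b :* l) refl (c 0) (c′ 0) (L 0)
  convolve-minus c c′ L (suc k) = trans
    (cong (λ x → (c 0 - c′ 0) * L (suc k) + x) (convolve-minus (c ∘ suc) (c′ ∘ suc) L k))
    (solve 5 (λ a b l x y → (a :- b) :* l :+ (x :- y) := (a :* l :+ x) :- (b :* l :+ y)) refl
      (c 0) (c′ 0) (L (suc k)) (convolve (c ∘ suc) L k) (convolve (c′ ∘ suc) L k))

  -- The hypotheses say that the series of `c′` is `1 - λ` times that of `c`; the product inherits
  -- the factor.
  convolve-difference : ∀ c c′ L → c′ 0 ≡ c 0 → (∀ j → c′ (suc j) ≡ c (suc j) - c j) →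
    ∀ k → convolve c′ L (suc k) ≡ convolve c L (suc k) - convolve c L k
  convolve-difference c c′ L head tail k = trans
    (cong₂ (λ x y → x * L (suc k) + y) head (trans (convolve-cong L k tail) (convolve-minus (c ∘ suc) c L k)))
    (sym (ℤ.+-assoc (c 0 * L (suc k)) _ _))

  -- The hypotheses say that `1 - λ` times the series of `L` is `1 + λ` times the series of `M`, and
  -- multiplication by the series of `c` preserves this.
  convolve-recurrence : ∀ c L M → L 0 ≡ M 0 → (∀ k → L (suc k) ≡ L k + (M (suc k) + M k)) →
    ∀ k → convolve c L (suc k) - convolve c L k ≡ convolve c M (suc k) + convolve c M k
  convolve-recurrence c L M base step zero rewrite step 0 | base =
    solve 4 (λ c₀ c₁ m₀ m₁ → (c₀ :* (m₀ :+ (m₁ :+ m₀)) :+ c₁ :* m₀) :- c₀ :* m₀ := (c₀ :* m₁ :+ c₁ :* m₀) :+ c₀ :* m₀)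
      refl (c 0) (c 1) (M 0) (M 1)
  convolve-recurrence c L M base step (suc k) = begin
    (c 0 * L (suc (suc k)) + X) - (c 0 * L (suc k) + Y)
      ≡⟨ cong (λ l → (c 0 * l + X) - (c 0 * L (suc k) + Y)) (step (suc k)) ⟩
    (c 0 * (L (suc k) + (M (suc (suc k)) + M (suc k))) + X) - (c 0 * L (suc k) + Y)
      ≡⟨ solve 6 (λ c l m m′ x y → (c :* (l :+ (m :+ m′)) :+ x) :- (c :* l :+ y) := c :* m :+ c :* m′ :+ (x :- y)) refl
           (c 0) (L (suc k)) (M (suc (suc k))) (M (suc k)) X Y ⟩
    c 0 * M (suc (suc k)) + c 0 * M (suc k) + (X - Y)
      ≡⟨ cong (λ x → c 0 * M (suc (suc k)) + c 0 * M (suc k) + x) (convolve-recurrence (c ∘ suc) L M base step k) ⟩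
    c 0 * M (suc (suc k)) + c 0 * M (suc k) + (convolve (c ∘ suc) M (suc k) + convolve (c ∘ suc) M k)
      ≡⟨ solve 4 (λ a b x y → a :+ b :+ (x :+ y) := (a :+ x) :+ (b :+ y)) refl
           (c 0 * M (suc (suc k))) (c 0 * M (suc k)) (convolve (c ∘ suc) M (suc k)) (convolve (c ∘ suc) M k) ⟩
    (c 0 * M (suc (suc k)) + convolve (c ∘ suc) M (suc k)) + (c 0 * M (suc k) + convolve (c ∘ suc) M k) ∎
    where
    open ≡-Reasoning
    X = convolve (c ∘ suc) L (suc k)
    Y = convolve (c ∘ suc) L k

  alternating : ℕ → ℤ
  alternating zero    = + 1
  alternating (suc j) = - alternating j

  -- The coefficients of `(1 - λ)^(N + 1)`.
  binomial : ℕ → ℕ → ℤ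
  binomial N j = alternating j * + (suc N C j)

  binomial-pascal : ∀ N j → binomial (suc N) (suc j) ≡ binomial N (suc j) - binomial N j
  binomial-pascal N j = trans
    (cong (λ x → - alternating j * x) (trans (cong +_ (sym (nCk+nC[k+1]≡[n+1]C[k+1] (suc N) j))) (ℤ.pos-+ (suc N C j) _)))
    (solve 3 (λ s x y → :- s :* (x :+ y) := :- s :* y :- s :* x) refl (alternating j) (+ (suc N C j)) (+ (suc N C suc j)))

  module _ (N : ℕ) (L : ℕ → ℕ) (k : ℕ) where

    term : ℕ → ℤ
    term j = binomial N j * + L (k ∸ j)

    -- The summand of `δcoeff` is anonymous; an unknown `g` lets unification name it. The term at
    -- `0` stands apart because `upTo (suc k)` computes to that index followed by a tail on which
    -- `map g` is stuck, and there `g` can be read off.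
    δcoeff-tail : ∃ λ (g : ℕ → ℤ) →
      δcoeff N L k ≡ + 1 * + ((suc N C 0) ℕ.* L k) + foldr _+_ (+ 0) (map g (applyUpTo suc k))
    δcoeff-tail = _ , refl

    -- The sign function is local to δcoeff and cannot be named.  Unification recovers it from the summands
    -- once the product of signs, on which it would get stuck, has been abstracted.
    δcoeff-sign : ∃ λ (s : ℕ → ℤ) → s 0 ≡ + 1 × (∀ j → s (suc j) ≡ - s j) ×
      (∀ j → proj₁ δcoeff-tail j ≡ s j * + ((suc N C j) ℕ.* L (k ∸ j)))
    δcoeff-sign with Sign._*_
    ... | _ = _ , refl , (λ _ → refl) , λ _ → refl

    δcoeff-summand : ∀ j → proj₁ δcoeff-tail j ≡ term j
    δcoeff-summand j with s , s₀ , sₛ , g≡ ← δcoeff-sign =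
      trans (g≡ j) (trans (cong₂ _*_ (s≡ j) (ℤ.pos-* (suc N C j) _)) (sym (ℤ.*-assoc (alternating j) _ _)))
      where
      s≡ : ∀ j → s j ≡ alternating j
      s≡ zero    = s₀
      s≡ (suc j) = trans (sₛ j) (cong -_ (s≡ j))

    δcoeff-convolve : δcoeff N L k ≡ convolve (binomial N) (λ i → + L i) k
    δcoeff-convolve = trans (proj₂ δcoeff-tail) (trans
      (cong₂ _+_ head (trans (sum-map (proj₁ δcoeff-tail) suc k) (partialSum-cong k (δcoeff-summand ∘ suc))))
      (convolve-partialSum (binomial N) (λ i → + L i) k))
      where
      head : + 1 * + ((suc N C 0) ℕ.* L k) ≡ term 0
      head = trans (cong (λ x → + 1 * x) (ℤ.pos-* (suc N C 0) (L k))) (sym (ℤ.*-assoc (+ 1) (+ (suc N C 0)) (+ L k)))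

  -- Ω has one more dimension and so one more factor `1 - λ`. The recurrence of the counts exchanges
  -- this factor, applied to the series of Ω, for `1 + λ` applied to the series of Γ.
  δcoeff-recurrence : ∀ d (LΓ LΩ : ℕ → ℕ) → LΩ 0 ≡ LΓ 0 →
    (∀ k → LΩ (suc k) ≡ LΩ k ℕ.+ (LΓ (suc k) ℕ.+ LΓ k)) →
    (δcoeff (suc d) LΩ 0 ≡ δcoeff d LΓ 0) ×
    (∀ k → δcoeff (suc d) LΩ (suc k) ≡ δcoeff d LΓ (suc k) + δcoeff d LΓ k)
  δcoeff-recurrence d LΓ LΩ base step =
    trans (δcoeff-convolve (suc d) LΩ 0) (trans (cong (λ x → + 1 * + x) base) (sym (δcoeff-convolve d LΓ 0))) ,
    λ k → begin
      δcoeff (suc d) LΩ (suc k)                                            ≡⟨ δcoeff-convolve (suc d) LΩ (suc k) ⟩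
      convolve (binomial (suc d)) (λ i → + LΩ i) (suc k)                   ≡⟨ convolve-difference (binomial d) (binomial (suc d)) (λ i → + LΩ i) refl (binomial-pascal d) k ⟩
      convolve (binomial d) (λ i → + LΩ i) (suc k) - convolve (binomial d) (λ i → + LΩ i) k
        ≡⟨ convolve-recurrence (binomial d) (λ i → + LΩ i) (λ i → + LΓ i) (cong +_ base) (λ k → cong +_ (step k)) k ⟩
      convolve (binomial d) (λ i → + LΓ i) (suc k) + convolve (binomial d) (λ i → + LΓ i) k
        ≡⟨ sym (cong₂ _+_ (δcoeff-convolve d LΓ (suc k)) (δcoeff-convolve d LΓ k)) ⟩
      δcoeff d LΓ (suc k) + δcoeff d LΓ k                                  ∎
    where open ≡-Reasoning

  -- A partial sum of `g` is the sum of two consecutive partial sums of `h`, and beyond `D` both of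
  -- these equal `v`. The factor `1 + λ` raises the degree bound to `suc D`.
  valueAt1-double : ∀ (h g : ℕ → ℤ) → g 0 ≡ h 0 → (∀ k → g (suc k) ≡ h (suc k) + h k) →
    ∀ v → IsValueAt1 h v → IsValueAt1 g (+ 2 * v)
  valueAt1-double h g base step v (D , vanish , total) = suc D , vanish′ , (begin
    foldr _+_ (+ 0) (map g (upTo (suc (suc D))))           ≡⟨ sum-upTo g (suc (suc D)) ⟩
    partialSum g (suc (suc D))                             ≡⟨ telescope (suc D) ⟩
    partialSum h (suc (suc D)) + partialSum h (suc D)      ≡⟨ cong (_+ partialSum h (suc D)) (partialSum-last h (suc D)) ⟩
    partialSum h (suc D) + h (suc D) + partialSum h (suc D) ≡⟨ cong₂ (λ x y → x + y + x) total′ (vanish (suc D) (ℕ.n<1+n D)) ⟩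
    v + + 0 + v                                            ≡⟨ solve 1 (λ v → v :+ con (+ 0) :+ v := con (+ 2) :* v) refl v ⟩
    + 2 * v                                                ∎)
    where
    open ≡-Reasoning
    total′ : partialSum h (suc D) ≡ v
    total′ = trans (sym (sum-upTo h (suc D))) total
    vanish′ : ∀ k → suc D < k → g k ≡ + 0
    vanish′ (suc k) (s≤s D<k) = trans (step k) (cong₂ _+_ (vanish (suc k) (ℕ.m<n⇒m<1+n D<k)) (vanish k D<k))
    telescope : ∀ n → partialSum g (suc n) ≡ partialSum h (suc n) + partialSum h n
    telescope zero = cong (_+ + 0) base ∙ sym (ℤ.+-identityʳ _)
      where _∙_ = trans
    telescope (suc n) = begin
      partialSum g (suc (suc n))                                  ≡⟨ partialSum-last g (suc n) ⟩
      partialSum g (suc n) + g (suc n)                            ≡⟨ cong₂ _+_ (telescope n) (step n) ⟩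
      (partialSum h (suc n) + partialSum h n) + (h (suc n) + h n) ≡⟨ solve 4 (λ a b c e → (a :+ b) :+ (c :+ e) := (a :+ c) :+ (b :+ e)) refl (partialSum h (suc n)) (partialSum h n) (h (suc n)) (h n) ⟩
      (partialSum h (suc n) + h (suc n)) + (partialSum h n + h n) ≡⟨ sym (cong₂ _+_ (partialSum-last h (suc n)) (partialSum-last h n)) ⟩
      partialSum h (suc (suc n)) + partialSum h (suc n)           ∎

open DeltaVectors

-- Counting finite sets of lattice points.

module Counting where
  open import Data.Nat using (_+_)
  open import Data.Nat.Properties
  open import Data.List using (_++_)
  open import Data.List.Properties using (length-++)
  open import Data.List.Membership.Propositional.Properties using (∈-∃++; ∈-++⁺ˡ; ∈-++⁺ʳ; ∈-++⁻)
  open import Data.List.Relation.Unary.Unique.Propositional.Properties using (++⁺)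

  unique-⊆-length : ∀ {a} {X : Set a} (xs ys : List X) → Unique xs → (∀ {x} → x ∈ xs → x ∈ ys) → length xs ≤ length ys
  unique-⊆-length []       ys _           _   = z≤n
  unique-⊆-length (x ∷ xs) ys (x∉xs ∷ xs!) sub with as , bs , refl ← ∈-∃++ (sub (here refl)) = begin
    suc (length xs)                 ≤⟨ s≤s (unique-⊆-length xs (as ++ bs) xs! sub′) ⟩
    suc (length (as ++ bs))         ≡⟨ cong suc (length-++ as) ⟩
    suc (length as + length bs)     ≡⟨ sym (+-suc (length as) (length bs)) ⟩
    length as + suc (length bs)     ≡⟨ sym (length-++ as) ⟩
    length (as ++ x ∷ bs)           ∎
    where
    open ≤-Reasoning
    sub′ : ∀ {y} → y ∈ xs → y ∈ as ++ bs
    sub′ y∈xs with ∈-++⁻ as (sub (there y∈xs))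
    ... | inj₁ y∈as         = ∈-++⁺ˡ y∈as
    ... | inj₂ (here refl)  = ⊥-elim (All.lookup x∉xs y∈xs refl)
    ... | inj₂ (there y∈bs) = ∈-++⁺ʳ as y∈bs

  count-unique : ∀ {N} {P Q : Vec ℤ N → Set} {a b} → IsCount P a → IsCount Q b →
    (∀ y → P y → Q y) → (∀ y → Q y → P y) → a ≡ b
  count-unique (xs , xs! , refl , memx) (ys , ys! , refl , memy) P⇒Q Q⇒P = ≤-antisym
    (unique-⊆-length xs ys xs! λ {y} y∈ → proj₂ (memy y) (P⇒Q y (proj₁ (memx y) y∈)))
    (unique-⊆-length ys xs ys! λ {y} y∈ → proj₂ (memx y) (Q⇒P y (proj₁ (memy y) y∈)))

  count-cong : ∀ {N} {P Q : Vec ℤ N → Set} {a} → (∀ y → P y → Q y) → (∀ y → Q y → P y) → IsCount P a → IsCount Q a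
  count-cong P⇒Q Q⇒P (xs , xs! , len , mem) = xs , xs! , len , λ y →
    (λ y∈ → P⇒Q y (proj₁ (mem y) y∈)) , (λ q → proj₂ (mem y) (Q⇒P y q))

  count-⊎ : ∀ {N} {P Q : Vec ℤ N → Set} {a b} → IsCount P a → IsCount Q b → (∀ y → P y → Q y → ⊥) →
    IsCount (λ y → P y ⊎ Q y) (a + b)
  count-⊎ {P = P} {Q} (xs , xs! , refl , memx) (ys , ys! , refl , memy) disjoint =
    xs ++ ys , ++⁺ xs! ys! (λ {y} (y∈xs , y∈ys) → disjoint y (proj₁ (memx y) y∈xs) (proj₁ (memy y) y∈ys)) ,
    length-++ xs , λ y →
      (λ y∈ → Sum.map (proj₁ (memx y)) (proj₁ (memy y)) (∈-++⁻ xs y∈)) ,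
      λ { (inj₁ p) → ∈-++⁺ˡ (proj₂ (memx y) p) ; (inj₂ q) → ∈-++⁺ʳ xs (proj₂ (memy y) q) }

  -- A relation in place of a function, because the image of `z` depends on the degrees of its pair,
  -- which are accessible only through `Rank`.
  module _ {M N} {P : Vec ℤ M → Set} (R : Vec ℤ M → Vec ℤ N → Set) (total : ∀ z → P z → ∃ (R z))
    (functional : ∀ {z y y′} → R z y → R z y′ → y ≡ y′) (injective : ∀ {z z′ y} → R z y → R z′ y → z ≡ z′) where

    image : ∀ xs → Unique xs → (∀ {z} → z ∈ xs → P z) → ∃ λ ys → Unique ys × length ys ≡ length xs ×
      (∀ y → (y ∈ ys → ∃ λ z → z ∈ xs × R z y) × ((∃ λ z → z ∈ xs × R z y) → y ∈ ys))
    image [] _ _ = [] , [] , refl , λ y → (λ ()) , λ ()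
    image (x ∷ xs) (x∉xs ∷ xs!) ps
      with ys , ys! , len , memy ← image xs xs! (λ z∈ → ps (there z∈))
         | y₀ , r₀ ← total x (ps (here refl)) =
      y₀ ∷ ys , All.tabulate fresh ∷ ys! , cong suc len , λ y →
        (λ { (here refl) → x , here refl , r₀
           ; (there y∈)  → let z , z∈ , r = proj₁ (memy y) y∈ in z , there z∈ , r }) ,
        λ { (z , here refl , r) → here (functional r r₀)
          ; (z , there z∈ , r)  → there (proj₂ (memy y) (z , z∈ , r)) }
      where
      fresh : ∀ {y} → y ∈ ys → y₀ ≢ y
      fresh y∈ refl = let z , z∈ , r = proj₁ (memy y₀) y∈ in All.lookup x∉xs z∈ (injective r₀ r)

    count-image : ∀ {a} → IsCount P a → IsCount (λ y → ∃ λ z → P z × R z y) a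
    count-image (xs , xs! , refl , mem)
      with ys , ys! , len , memy ← image xs xs! (λ {z} z∈ → proj₁ (mem z) z∈) =
      ys , ys! , len , λ y →
        (λ y∈ → let z , z∈ , r = proj₁ (memy y) y∈ in z , proj₁ (mem z) z∈ , r) ,
        λ (z , p , r) → proj₂ (memy y) (z , proj₂ (mem z) p , r)

open Counting

-- Membership in dilates by degrees, and the recurrence of Ehrhart functions.

module EhrhartRecurrence where
  open import Data.Nat using (_+_; _*_)
  open import Data.Nat.Properties
  open import Data.Vec using (initLast)

  module Ehrhart {d n m} (A : Vec (Vec ℕ d) (suc n)) (B : Vec (Vec ℕ d) (suc m))
    (A-last : last A ≡ 𝟘) (B-last : last B ≡ 𝟘) (harmony : Harmony A B)
    (SA : StandardMonomials A) (SB : StandardMonomials B)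
    (generated : LatticeGen (ΓV A B)) (points : ΓPointsHyp A B) where

    open Signed A B
    open Points A B
    open Lattice A B generated points
    private
      module ZA = ZeroLast A A-last
      module ZB = ZeroLast B B-last

    Rk : Vec ℤ d → ℕ → ℕ → Set
    Rk = Rank harmony SA SB

    Rk-unique : ∀ {z α β α′ β′} → Rk z α β → Rk z α′ β′ → α ≡ α′ × β ≡ β′
    Rk-unique {z} = rank-unique harmony SA SB {z}

    InΓ : ℕ → Vec ℤ d → Set
    InΓ k z = ∃ λ α → ∃ λ β → Rk z α β × α + β ≤ k

    -- p and q stand for k + t and k − t.
    InΩ : ℕ → Vec ℤ d → ℤ → Set
    InΩ k z t = ∃ λ α → ∃ λ β → ∃ λ p → ∃ λ q → Rk z α β ×
      2 * α ≤ p × 2 * β ≤ q × p + q ≡ 2 * k × t ≡ + p ℤ.- + k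

    rank-bound : ∀ z N u v → (∀ i → ⟦ u , v ⟧ i ≡ + suc N ℤ.* lookup z i) →
      ∃ λ α → ∃ λ β → Rk z α β × suc N * α ≤ deg u × suc N * β ≤ deg v
    rank-bound z N u v multiple = let s , t , s′ , t′ , rep = lattice z in
      rank-of-multiple harmony SA SB z N u v s t s′ t′ multiple rep

    -- The weights in a dilate must have an exact sum, while standard pairs only have bounded
    -- degrees. The zero columns absorb the slack.
    padded : ∀ u v a b i → ⟦ u ⊕ (a ⊛ unit (fromℕ n)) , v ⊕ (b ⊛ unit (fromℕ m)) ⟧ i ≡ ⟦ u , v ⟧ i
    padded u v a b i = cong₂ (λ x y → + lookup x i ℤ.- + lookup y i) (ZA.matVec-⊕-last u a) (ZB.matVec-⊕-last v b)

    dilate-Γ⁺ : ∀ {k z} → InDil k (ΓV A B) z → InΓ k z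
    dilate-Γ⁺ {k} {z} dil = from (Γ-multiple⁺ {k} {z} dil)
      where
      from : Γ-Multiple k z → InΓ k z
      from (N , u , v , total , multiple) = let α , β , rk , Nα , Nβ = rank-bound z N u v multiple in
        α , β , rk , *-cancelˡ-≤ (suc N) (begin
          suc N * (α + β)           ≡⟨ *-distribˡ-+ (suc N) α β ⟩
          suc N * α + suc N * β     ≤⟨ +-mono-≤ Nα Nβ ⟩
          deg u + deg v             ≡⟨ total ⟩
          suc N * k                 ∎)
        where open ≤-Reasoning

    dilate-Γ⁻ : ∀ {k z} → InΓ k z → InDil k (ΓV A B) z
    dilate-Γ⁻ {k} {z} (α , β , (u , v , _ , uv≡z , refl , refl) , α+β≤k) = Γ-multiple⁻ {k} {z}
      -- The multiplier is `0 + 1`: for Γ the degrees already are admissible weights, and all the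
      -- slack goes to the zero column of `A`.
      (0 , u ⊕ (s ⊛ unit (fromℕ n)) , v ⊕ (0 ⊛ unit (fromℕ m)) , total ,
       λ i → trans (padded u v s 0 i) (trans (uv≡z i) (sym (ℤ.*-identityˡ _))))
      where
      s = k ∸ (deg u + deg v)
      total : deg (u ⊕ (s ⊛ unit (fromℕ n))) + deg (v ⊕ (0 ⊛ unit (fromℕ m))) ≡ 1 * k
      total = begin
        deg (u ⊕ (s ⊛ unit (fromℕ n))) + deg (v ⊕ (0 ⊛ unit (fromℕ m))) ≡⟨ cong₂ _+_ (ZA.deg-⊕-last u s) (ZB.deg-⊕-last v 0) ⟩
        (deg u + s) + (deg v + 0)                                       ≡⟨ solve 3 (λ a b s → (a :+ s) :+ (b :+ con 0) := (a :+ b) :+ s) refl (deg u) (deg v) s ⟩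
        (deg u + deg v) + s                                             ≡⟨ m+[n∸m]≡n α+β≤k ⟩
        k                                                               ≡⟨ sym (*-identityˡ k) ⟩
        1 * k                                                           ∎
        where
        open ≡-Reasoning
        open ℕSolver.+-*-Solver using (solve; _:+_; _:=_; con)

    -- This makes `k + t` and `k - t` natural numbers, since their multiples by `N + 1` are twice a
    -- degree.
    nonneg-quotient : ∀ N {x c} → + c ≡ + suc N ℤ.* x → ∃ λ p → x ≡ + p × c ≡ suc N * p
    nonneg-quotient N {+ p}      eq = p , refl , ℤ.+-injective (trans eq (sym (ℤ.pos-* (suc N) p)))
    nonneg-quotient N { -[1+ p ]} ()

    -- The sum and the difference of the total weight `(N + 1) k` and the height `(N + 1) t` isolate
    -- twice each degree, so the separate bounds on the two degrees become bounds by `k + t` and by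
    -- `k - t`.
    dilate-Ω⁺ : ∀ {k z t} → InDil k (ΩV A B) (z ∷ʳ t) → InΩ k z t
    dilate-Ω⁺ {k} {z} {t} dil = from (Ω-multiple⁺ {k} {z} {t} dil)
      where
      from : Ω-Multiple k z t → InΩ k z t
      from (N , u , v , total , multiple , height) =
        let α , β , rk , Nα , Nβ = rank-bound z N u v multiple
            p , k+t≡p , 2u≡Np    = nonneg-quotient N {+ k ℤ.+ t} {2 * deg u} plus
            q , k-t≡q , 2v≡Nq    = nonneg-quotient N {+ k ℤ.- t} {2 * deg v} minus
        in α , β , p , q , rk , twice {α} {p} Nα 2u≡Np , twice {β} {q} Nβ 2v≡Nq , p+q≡2k k+t≡p k-t≡q ,
           trans (solve 2 (λ k t → t := (k :+ t) :- k) refl (+ k) t) (cong (ℤ._- + k) k+t≡p)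
        where
        open ℤSolver.+-*-Solver using (solve; _:+_; _:*_; _:-_; _:=_; con)
        open ≡-Reasoning
        total′ : + deg u ℤ.+ + deg v ≡ + suc N ℤ.* + k
        total′ = trans (cong +_ total) (ℤ.pos-* (suc N) k)
        plus : + (2 * deg u) ≡ + suc N ℤ.* (+ k ℤ.+ t)
        plus = begin
          + (2 * deg u)                                                     ≡⟨ ℤ.pos-* 2 (deg u) ⟩
          + 2 ℤ.* + deg u                                                   ≡⟨ solve 2 (λ a b → con (+ 2) :* a := (a :+ b) :+ (a :- b)) refl (+ deg u) (+ deg v) ⟩
          (+ deg u ℤ.+ + deg v) ℤ.+ (+ deg u ℤ.- + deg v)                   ≡⟨ cong₂ ℤ._+_ total′ height ⟩
          + suc N ℤ.* + k ℤ.+ + suc N ℤ.* t                                 ≡⟨ sym (ℤ.*-distribˡ-+ (+ suc N) (+ k) t) ⟩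
          + suc N ℤ.* (+ k ℤ.+ t)                                           ∎
        minus : + (2 * deg v) ≡ + suc N ℤ.* (+ k ℤ.- t)
        minus = begin
          + (2 * deg v)                                                     ≡⟨ ℤ.pos-* 2 (deg v) ⟩
          + 2 ℤ.* + deg v                                                   ≡⟨ solve 2 (λ a b → con (+ 2) :* b := (a :+ b) :- (a :- b)) refl (+ deg u) (+ deg v) ⟩
          (+ deg u ℤ.+ + deg v) ℤ.- (+ deg u ℤ.- + deg v)                   ≡⟨ cong₂ ℤ._-_ total′ height ⟩
          + suc N ℤ.* + k ℤ.- + suc N ℤ.* t                                 ≡⟨ solve 3 (λ n k t → n :* k :- n :* t := n :* (k :- t)) refl (+ suc N) (+ k) t ⟩
          + suc N ℤ.* (+ k ℤ.- t)                                           ∎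
        twice : ∀ {α p e} → suc N * α ≤ e → 2 * e ≡ suc N * p → 2 * α ≤ p
        twice {α} {p} {e} Nα≤e 2e≡Np = *-cancelˡ-≤ (suc N) (≤-trans (≤-reflexive swap) (≤-trans (*-monoʳ-≤ 2 Nα≤e) (≤-reflexive 2e≡Np)))
          where
          swap : suc N * (2 * α) ≡ 2 * (suc N * α)
          swap = trans (sym (*-assoc (suc N) 2 α)) (trans (cong (_* α) (*-comm (suc N) 2)) (*-assoc 2 (suc N) α))
        p+q≡2k : ∀ {p q} → + k ℤ.+ t ≡ + p → + k ℤ.- t ≡ + q → p + q ≡ 2 * k
        p+q≡2k {p} {q} k+t≡p k-t≡q = ℤ.+-injective (begin
          + p ℤ.+ + q                        ≡⟨ sym (cong₂ ℤ._+_ k+t≡p k-t≡q) ⟩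
          (+ k ℤ.+ t) ℤ.+ (+ k ℤ.- t)        ≡⟨ solve 2 (λ k t → (k :+ t) :+ (k :- t) := con (+ 2) :* k) refl (+ k) t ⟩
          + 2 ℤ.* + k                        ≡⟨ sym (ℤ.pos-* 2 k) ⟩
          + (2 * k)                          ∎)

    -- Doubling makes room for the weights (k ± t)/2, which need not be integral.
    dilate-Ω⁻ : ∀ {k z t} → InΩ k z t → InDil k (ΩV A B) (z ∷ʳ t)
    dilate-Ω⁻ {k} {z} {t} (α , β , p , q , (u , v , _ , uv≡z , refl , refl) , 2α≤p , 2β≤q , p+q≡2k , t≡p-k) =
      Ω-multiple⁻ {k} {z} {t} (1 , u′ , v′ , trans (cong₂ _+_ deg-u′ deg-v′) p+q≡2k ,
        (λ i → trans (padded (2 ⊛ u) (2 ⊛ v) a b i) (trans (⟦⟧-⊛ 2 u v i) (cong (+ 2 ℤ.*_) (uv≡z i)))) ,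
        (begin
          + deg u′ ℤ.- + deg v′               ≡⟨ cong₂ (λ x y → + x ℤ.- + y) deg-u′ deg-v′ ⟩
          + p ℤ.- + q                         ≡⟨ solve 2 (λ p q → p :- q := con (+ 2) :* p :- (p :+ q)) refl (+ p) (+ q) ⟩
          + 2 ℤ.* + p ℤ.- (+ p ℤ.+ + q)       ≡⟨ cong (λ x → + 2 ℤ.* + p ℤ.- x) (trans (cong +_ p+q≡2k) (ℤ.pos-* 2 k)) ⟩
          + 2 ℤ.* + p ℤ.- + 2 ℤ.* + k         ≡⟨ solve 2 (λ p k → con (+ 2) :* p :- con (+ 2) :* k := con (+ 2) :* (p :- k)) refl (+ p) (+ k) ⟩
          + 2 ℤ.* (+ p ℤ.- + k)               ≡⟨ cong (+ 2 ℤ.*_) (sym t≡p-k) ⟩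
          + 2 ℤ.* t                           ∎))
      where
      open ℤSolver.+-*-Solver using (solve; _:+_; _:*_; _:-_; _:=_; con)
      open ≡-Reasoning
      a = p ∸ 2 * deg u
      b = q ∸ 2 * deg v
      u′ = (2 ⊛ u) ⊕ (a ⊛ unit (fromℕ n))
      v′ = (2 ⊛ v) ⊕ (b ⊛ unit (fromℕ m))
      deg-u′ : deg u′ ≡ p
      deg-u′ = trans (ZA.deg-⊕-last (2 ⊛ u) a) (trans (cong (_+ a) (deg-⊛ 2 u)) (m+[n∸m]≡n 2α≤p))
      deg-v′ : deg v′ ≡ q
      deg-v′ = trans (ZB.deg-⊕-last (2 ⊛ v) b) (trans (cong (_+ b) (deg-⊛ 2 v)) (m+[n∸m]≡n 2β≤q))

    0ᵈ : Vec ℤ d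
    0ᵈ = replicate d (+ 0)

    InΓ-0 : ∀ z → InΓ 0 z → z ≡ 0ᵈ
    InΓ-0 z (α , β , (u , v , _ , uv≡z , du , dv) , α+β≤0) = lookup-ext λ i →
      trans (sym (uv≡z i)) (trans (cong₂ (λ x y → ⟦ x , y ⟧ i) (zero-deg u (trans du α≡0)) (zero-deg v (trans dv β≡0)))
        (trans (⟦𝟘⟧ʳ 𝟘 i) (trans (cong (λ w → + lookup w i) (matVec-𝟘 A)) (trans (cong +_ (lookup-𝟘 i)) (sym (lookup-replicate i (+ 0)))))))
      where
      α≡0 : α ≡ 0
      α≡0 = m+n≡0⇒m≡0 α (n≤0⇒n≡0 α+β≤0)
      β≡0 : β ≡ 0
      β≡0 = m+n≡0⇒n≡0 α (n≤0⇒n≡0 α+β≤0)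
      zero-deg : ∀ {l} (w : Mon l) → deg w ≡ 0 → w ≡ 𝟘
      zero-deg w eq = lookup-ext λ i → trans (n≤0⇒n≡0 (subst (lookup w i ≤_) eq (lookup≤deg w i))) (sym (lookup-𝟘 i))

    rank-0 : Rk 0ᵈ 0 0
    rank-0 = from (rank-bound 0ᵈ 0 𝟘 𝟘 λ i → trans (⟦𝟘⟧ʳ 𝟘 i) (trans (cong (λ w → + lookup w i) (matVec-𝟘 A))
      (trans (cong +_ (lookup-𝟘 i)) (sym (trans (ℤ.*-identityˡ _) (lookup-replicate i (+ 0)))))))
      where
      vanish : ∀ {α l} → 1 * α ≤ deg (𝟘 {l}) → α ≡ 0
      vanish {α} {l} le = n≤0⇒n≡0 (subst₂ _≤_ (*-identityˡ α) (deg-𝟘 {l}) le)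
      from : (∃ λ α → ∃ λ β → Rk 0ᵈ α β × 1 * α ≤ deg (𝟘 {suc n}) × 1 * β ≤ deg (𝟘 {suc m})) → Rk 0ᵈ 0 0
      from (α , β , rk , α≤ , β≤) = subst₂ (Rk 0ᵈ) (vanish {l = suc n} α≤) (vanish {l = suc m} β≤) rk

    OnΩ : ℕ → Vec ℤ (suc d) → Set
    OnΩ k y = ∃ λ z → ∃ λ t → y ≡ z ∷ʳ t × InΩ k z t

    -- Above a fixed `z`, the admissible heights in the dilate of Ω by `k + 1` form an interval, and
    -- these are its two ends. Passing from `k + 1` to `k` removes exactly the ends.
    Lower Upper : ℕ → Vec ℤ d → Vec ℤ (suc d) → Set
    Lower k z y = ∃ λ α → ∃ λ β → Rk z α β × y ≡ z ∷ʳ (+ (2 * α) ℤ.- + suc k)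
    Upper k z y = ∃ λ α → ∃ λ β → Rk z α β × y ≡ z ∷ʳ (+ suc k ℤ.- + (2 * β))

    module _ (LΓ LΩ : ℕ → ℕ) (specΓ : EhrhartSpec (ΓV A B) LΓ) (specΩ : EhrhartSpec (ΩV A B) LΩ) where

      -- `EhrhartSpec` prescribes the value at `0` instead of counting. The recurrence at `k = 0`
      -- needs this value as a count, so the zeroth dilate is shown to consist of the origin.
      countΓ : ∀ k → IsCount (InΓ k) (LΓ k)
      countΓ (suc k) = count-cong (λ z → dilate-Γ⁺ {suc k} {z}) (λ z → dilate-Γ⁻ {suc k} {z}) (proj₂ specΓ k)
      countΓ zero = 0ᵈ ∷ [] , [] ∷ [] , sym (proj₁ specΓ) , λ z →
        (λ { (here refl) → 0 , 0 , rank-0 , z≤n }) , λ in0 → here (InΓ-0 z in0)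

      countΩ : ∀ k → IsCount (OnΩ k) (LΩ k)
      countΩ (suc k) = count-cong onΩ inΩ (proj₂ specΩ k)
        where
        onΩ : ∀ y → InDil (suc k) (ΩV A B) y → OnΩ (suc k) y
        onΩ y dil with z , t , refl ← initLast y = z , t , refl , dilate-Ω⁺ {suc k} {z} {t} dil
        inΩ : ∀ y → OnΩ (suc k) y → InDil (suc k) (ΩV A B) y
        inΩ _ (z , t , refl , inside) = dilate-Ω⁻ {suc k} {z} {t} inside
      countΩ zero = (0ᵈ ∷ʳ + 0) ∷ [] , [] ∷ [] , sym (proj₁ specΩ) , λ y →
        (λ { (here refl) → 0ᵈ , + 0 , refl , 0 , 0 , 0 , 0 , rank-0 , z≤n , z≤n , refl , refl }) ,
        λ { (z , t , refl , α , β , p , q , rk , 2α≤p , 2β≤q , p+q≡0 , t≡) →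
              here (cong₂ _∷ʳ_ (InΓ-0 z (α , β , rk , small {α} {β} 2α≤p 2β≤q p+q≡0)) (trans t≡ (cong (λ x → + x ℤ.- + 0) (m+n≡0⇒m≡0 p p+q≡0)))) }
        where
        small : ∀ {α β p q} → 2 * α ≤ p → 2 * β ≤ q → p + q ≡ 0 → α + β ≤ 0
        small {α} {β} {p} 2α≤p 2β≤q eq = +-mono-≤
          (≤-trans (m≤n*m α 2) (≤-trans 2α≤p (≤-reflexive (m+n≡0⇒m≡0 p eq))))
          (≤-trans (m≤n*m β 2) (≤-trans 2β≤q (≤-reflexive (m+n≡0⇒n≡0 p eq))))

      -- A lattice point (z , t) of (k + 1)Ω has (k + 1) + t ≥ 2 α and (k + 1) − t ≥ 2 β; it lies in kΩ
      -- unless one of the two is an equality.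
      recurrence : ∀ k → LΩ (suc k) ≡ LΩ k + (LΓ (suc k) + LΓ k)
      recurrence k = count-unique (countΩ (suc k))
        (count-⊎ (countΩ k) (count-⊎ (count-image (Lower k) lower-total lower-functional lower-injective (countΓ (suc k)))
          (count-image (Upper k) upper-total upper-functional upper-injective (countΓ k)) lower-upper) inner-outer)
        split join
        where
        open ℤSolver.+-*-Solver using (solve; _:+_; _:*_; _:-_; _:=_; con)

        lower-total : ∀ z → InΓ (suc k) z → ∃ (Lower k z)
        lower-total z (α , β , rk , _) = _ , α , β , rk , refl
        upper-total : ∀ z → InΓ k z → ∃ (Upper k z)
        upper-total z (α , β , rk , _) = _ , α , β , rk , refl

        lower-functional : ∀ {z y y′} → Lower k z y → Lower k z y′ → y ≡ y′
        lower-functional {z} (α , β , rk , refl) (α′ , β′ , rk′ , refl)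
          with refl , refl ← Rk-unique {z} rk rk′ = refl
        upper-functional : ∀ {z y y′} → Upper k z y → Upper k z y′ → y ≡ y′
        upper-functional {z} (α , β , rk , refl) (α′ , β′ , rk′ , refl)
          with refl , refl ← Rk-unique {z} rk rk′ = refl

        lower-injective : ∀ {z z′ y} → Lower k z y → Lower k z′ y → z ≡ z′
        lower-injective {z} {z′} (_ , _ , _ , refl) (_ , _ , _ , eq) = proj₁ (∷ʳ-injective z z′ eq)
        upper-injective : ∀ {z z′ y} → Upper k z y → Upper k z′ y → z ≡ z′
        upper-injective {z} {z′} (_ , _ , _ , refl) (_ , _ , _ , eq) = proj₁ (∷ʳ-injective z z′ eq)

        double-sum : ∀ {α β c} → 2 * α + 2 * β ≡ 2 * c → α + β ≡ c
        double-sum {α} {β} {c} eq = *-cancelˡ-≡ (α + β) c 2 (trans (*-distribˡ-+ 2 α β) eq)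

        -- The two ends coincide exactly when `α + β = k + 1`. Such a point belongs to the lower
        -- family, so the upper one ranges only over the dilate of Γ by `k`.
        lower-upper : ∀ y → (∃ λ z → InΓ (suc k) z × Lower k z y) → (∃ λ z → InΓ k z × Upper k z y) → ⊥
        lower-upper y (z , _ , α , β , rk , refl) (z′ , (α₁ , β₁ , rk₁ , α₁+β₁≤k) , α′ , β′ , rk′ , eq)
          with refl , t≡ ← ∷ʳ-injective z z′ eq
          with refl , refl ← Rk-unique {z} rk rk′
          with refl , refl ← Rk-unique {z} rk rk₁ = 1+n≰n (≤-trans (≤-reflexive (sym α+β≡1+k)) α₁+β₁≤k)
          where
          α+β≡1+k : α + β ≡ suc k
          α+β≡1+k = double-sum {α} {β} (ℤ.+-injective (begin
            + (2 * α) ℤ.+ + (2 * β)                                ≡⟨ solve 3 (λ a b c → a :+ b := (a :- c) :+ b :+ c) refl (+ (2 * α)) (+ (2 * β)) (+ suc k) ⟩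
            (+ (2 * α) ℤ.- + suc k) ℤ.+ + (2 * β) ℤ.+ + suc k      ≡⟨ cong (λ x → x ℤ.+ + (2 * β) ℤ.+ + suc k) t≡ ⟩
            (+ suc k ℤ.- + (2 * β)) ℤ.+ + (2 * β) ℤ.+ + suc k      ≡⟨ solve 2 (λ b c → (c :- b) :+ b :+ c := con (+ 2) :* c) refl (+ (2 * β)) (+ suc k) ⟩
            + 2 ℤ.* + suc k                                        ≡⟨ sym (ℤ.pos-* 2 (suc k)) ⟩
            + (2 * suc k)                                          ∎))
            where open ≡-Reasoning

        -- In (k + 1)Ω the value k + t + 1 of a point of kΩ exceeds 2 α, and likewise for k − t + 1.
        inner-outer : ∀ y → OnΩ k y → (∃ λ z → InΓ (suc k) z × Lower k z y) ⊎ (∃ λ z → InΓ k z × Upper k z y) → ⊥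
        inner-outer y (z , t , refl , α , β , p , q , rk , 2α≤p , 2β≤q , p+q≡2k , refl) (inj₁ (z′ , _ , α′ , β′ , rk′ , eq))
          with refl , t≡ ← ∷ʳ-injective z z′ eq
          with refl , refl ← Rk-unique {z} rk rk′ = 1+n≰n (≤-trans (≤-reflexive 1+p≡2α) 2α≤p)
          where
          1+p≡2α : suc p ≡ 2 * α
          1+p≡2α = ℤ.+-injective (begin
            + suc p                                      ≡⟨ solve 2 (λ p k → con (+ 1) :+ p := (p :- k) :+ (con (+ 1) :+ k)) refl (+ p) (+ k) ⟩
            (+ p ℤ.- + k) ℤ.+ + suc k                    ≡⟨ cong (ℤ._+ + suc k) t≡ ⟩
            (+ (2 * α) ℤ.- + suc k) ℤ.+ + suc k          ≡⟨ solve 2 (λ a c → (a :- c) :+ c := a) refl (+ (2 * α)) (+ suc k) ⟩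
            + (2 * α)                                    ∎)
            where open ≡-Reasoning
        inner-outer y (z , t , refl , α , β , p , q , rk , 2α≤p , 2β≤q , p+q≡2k , refl) (inj₂ (z′ , _ , α′ , β′ , rk′ , eq))
          with refl , t≡ ← ∷ʳ-injective z z′ eq
          with refl , refl ← Rk-unique {z} rk rk′ = 1+n≰n (≤-trans (≤-reflexive 1+q≡2β) 2β≤q)
          where
          1+q≡2β : suc q ≡ 2 * β
          1+q≡2β = ℤ.+-injective (begin
            + suc q                                                                ≡⟨ solve 3 (λ p q k → con (+ 1) :+ q := ((p :+ q) :- k :+ con (+ 1)) :- (p :- k)) refl (+ p) (+ q) (+ k) ⟩
            ((+ p ℤ.+ + q) ℤ.- + k ℤ.+ + 1) ℤ.- (+ p ℤ.- + k)                      ≡⟨ cong₂ (λ x y → (x ℤ.- + k ℤ.+ + 1) ℤ.- y) (trans (cong +_ p+q≡2k) (ℤ.pos-* 2 k)) t≡ ⟩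
            (+ 2 ℤ.* + k ℤ.- + k ℤ.+ + 1) ℤ.- (+ suc k ℤ.- + (2 * β))              ≡⟨ solve 2 (λ k b → (con (+ 2) :* k :- k :+ con (+ 1)) :- ((con (+ 1) :+ k) :- b) := b) refl (+ k) (+ (2 * β)) ⟩
            + (2 * β)                                                              ∎)
            where open ≡-Reasoning

        Parts : Vec ℤ (suc d) → Set
        Parts y = OnΩ k y ⊎ ((∃ λ z → InΓ (suc k) z × Lower k z y) ⊎ (∃ λ z → InΓ k z × Upper k z y))

        split : ∀ y → OnΩ (suc k) y → Parts y
        split _ (z , _ , refl , α , β , p , q , rk , 2α≤p , 2β≤q , p+q≡ , refl) with 2 * α ℕ.≟ p | 2 * β ℕ.≟ q
        ... | yes refl | _ = inj₂ (inj₁ (z , (α , β , rk , *-cancelˡ-≤ 2 (begin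
                2 * (α + β)       ≡⟨ *-distribˡ-+ 2 α β ⟩
                2 * α + 2 * β     ≤⟨ +-monoʳ-≤ (2 * α) 2β≤q ⟩
                2 * α + q         ≡⟨ p+q≡ ⟩
                2 * suc k         ∎)) , α , β , rk , refl))
          where open ≤-Reasoning
        -- Strictness at the lower end gives `α + β < k + 1`, the sharper bound that the upper
        -- family demands.
        ... | no 2α≢p | yes refl = inj₂ (inj₂ (z , (α , β , rk , ≤-pred (*-cancelˡ-< 2 (α + β) (suc k) (begin-strict
                2 * (α + β)       ≡⟨ *-distribˡ-+ 2 α β ⟩
                2 * α + 2 * β     <⟨ +-monoˡ-< (2 * β) (≤∧≢⇒< 2α≤p 2α≢p) ⟩
                p + 2 * β         ≡⟨ p+q≡ ⟩
                2 * suc k         ∎))) , α , β , rk , cong (z ∷ʳ_) height))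
          where
          open ≤-Reasoning
          height : + p ℤ.- + suc k ≡ + suc k ℤ.- + (2 * β)
          height = ≡-difference p (suc k) (suc k) (2 * β) (trans p+q≡ (cong (λ x → suc k + x) (+-identityʳ (suc k))))
        ... | no 2α≢p | no 2β≢q = inner (≤∧≢⇒< 2α≤p 2α≢p) (≤∧≢⇒< 2β≤q 2β≢q) p+q≡
          where
          -- Both inequalities are strict, so `k + 1 + t` and `k + 1 - t` can each drop by one; this
          -- lowers the dilation factor by one and keeps `t`.
          inner : ∀ {p q} → 2 * α < p → 2 * β < q → p + q ≡ 2 * suc k → Parts (z ∷ʳ (+ p ℤ.- + suc k))
          inner {suc p} {suc q} (s≤s 2α≤p) (s≤s 2β≤q) eq = inj₁ (z , _ , refl , α , β , p , q , rk , 2α≤p , 2β≤q ,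
            +-cancelˡ-≡ 2 (p + q) (2 * k) (trans (cong suc (sym (+-suc p q))) (trans eq (*-suc 2 k))) ,
            ≡-difference (suc p) (suc k) p k (sym (+-suc p k)))

        join : ∀ y → Parts y → OnΩ (suc k) y
        join _ (inj₁ (z , _ , refl , α , β , p , q , rk , 2α≤p , 2β≤q , p+q≡ , refl)) =
          z , _ , refl , α , β , suc p , suc q , rk , m≤n⇒m≤1+n 2α≤p , m≤n⇒m≤1+n 2β≤q ,
          trans (cong suc (+-suc p q)) (trans (cong (λ x → 2 + x) p+q≡) (sym (*-suc 2 k))) ,
          ≡-difference p k (suc p) (suc k) (+-suc p k)
        join _ (inj₂ (inj₁ (z , (α₁ , β₁ , rk₁ , bound) , α , β , rk , refl)))
          with refl , refl ← Rk-unique {z} rk rk₁ =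
          z , _ , refl , α , β , 2 * α , 2 * suc k ∸ 2 * α , rk , ≤-refl ,
          m+n≤o⇒m≤o∸n (2 * β) (≤-trans (≤-reflexive (trans (+-comm (2 * β) (2 * α)) (sym (*-distribˡ-+ 2 α β)))) (*-monoʳ-≤ 2 bound)) ,
          m+[n∸m]≡n (*-monoʳ-≤ 2 (≤-trans (m≤m+n α β) bound)) , refl
        join _ (inj₂ (inj₂ (z , (α₁ , β₁ , rk₁ , bound) , α , β , rk , refl)))
          with refl , refl ← Rk-unique {z} rk rk₁ =
          z , _ , refl , α , β , p , 2 * β , rk ,
          m+n≤o⇒m≤o∸n (2 * α) (≤-trans (≤-reflexive (sym (*-distribˡ-+ 2 α β))) (*-monoʳ-≤ 2 bound′)) , ≤-refl ,
          p+q≡ , sym (≡-difference p (suc k) (suc k) (2 * β) (trans p+q≡ (cong (λ x → suc k + x) (+-identityʳ (suc k)))))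
          where
          bound′ : α + β ≤ suc k
          bound′ = m≤n⇒m≤1+n bound
          p = 2 * suc k ∸ 2 * β
          p+q≡ : p + 2 * β ≡ 2 * suc k
          p+q≡ = m∸n+n≡m (*-monoʳ-≤ 2 (≤-trans (m≤n+m β α) bound′))

      δ-doubling : ((δcoeff (suc d) LΩ 0 ≡ δcoeff d LΓ 0) ×
         (∀ k → δcoeff (suc d) LΩ (suc k) ≡ δcoeff d LΓ (suc k) ℤ.+ δcoeff d LΓ k)) ×
        (∀ v → IsValueAt1 (δcoeff d LΓ) v → IsValueAt1 (δcoeff (suc d) LΩ) (+ 2 ℤ.* v))
      δ-doubling = let base , step = δ-step in (base , step) , valueAt1-double (δcoeff d LΓ) (δcoeff (suc d) LΩ) base step
        where δ-step = δcoeff-recurrence d LΓ LΩ (trans (proj₁ specΩ) (sym (proj₁ specΓ))) recurrence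

open EhrhartRecurrence

open import Data.Integer using (_+_; _*_)

theorem3p1 : ∀ {c ℓ} (K : Field c ℓ) (d n m : ℕ)
    (A : Vec (Vec ℕ d) (suc n)) (B : Vec (Vec ℕ d) (suc m)) →
    last A ≡ replicate d 0 → last B ≡ replicate d 0 →
    Harmony A B →
    (rA : Fin (suc n) → ℕ) → Injective _≡_ _≡_ rA →
    (∀ i j → i ≢ j → (∀ k → lookup (lookup A i) k ≤ lookup (lookup A j) k) → rA i < rA j) →
    (∀ i → i ≢ fromℕ n → rA (fromℕ n) < rA i) →
    Poly.SquarefreeInitial K A rA →
    (rB : Fin (suc m) → ℕ) → Injective _≡_ _≡_ rB →
    (∀ i → i ≢ fromℕ m → rB (fromℕ m) < rB i) →
    Poly.SquarefreeInitial K B rB →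
    LatticeGen (ΓV A B) → LatticeGen (ΩV A B) →
    ΓPointsHyp A B → ΩPointsHyp A B →
    (LΓ LΩ : ℕ → ℕ) → EhrhartSpec (ΓV A B) LΓ → EhrhartSpec (ΩV A B) LΩ →
    ((δcoeff (suc d) LΩ 0 ≡ δcoeff d LΓ 0) ×
     (∀ k → δcoeff (suc d) LΩ (suc k) ≡ δcoeff d LΓ (suc k) + δcoeff d LΓ k)) ×
    (∀ v → IsValueAt1 (δcoeff d LΓ) v → IsValueAt1 (δcoeff (suc d) LΩ) (+ 2 * v))
theorem3p1 K d n m A B A-last B-last harmony rA rA-injective _ rA-last squarefreeA rB rB-injective rB-last squarefreeB
  generated _ points _ LΓ LΩ specΓ specΩ =
  Ehrhart.δ-doubling A B A-last B-last harmony
    (Standard.standardMonomials A A-last rA rA-injective rA-last K squarefreeA)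
    (Standard.standardMonomials B B-last rB rB-injective rB-last K squarefreeB)
    generated points LΓ LΩ specΓ specΩ
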